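{- For every positive integer $n$, $$\hat{r}(P_3,F_n)= \begin{cases}10, & \text{if } n=2;\\ 4n+4, & \text{if } n \text{ is odd};\\ 4n+5, & \text{if } n \text{ is even and } n\neq 2.\end{cases}$$
   Context: All graphs are finite and simple. For graphs $G_1,G_2$, the size Ramsey number $\hat{r}(G_1,G_2)$ is the smallest positive integer $m$ such that there exists a graph $G$ with $m$ edges with the property that for every coloring of the edges of $G$ with red and blue, $G$ contains a red subgraph isomorphic to $G_1$ or a blue subgraph isomorphic to $G_2$. $P_3$ denotes the path on $3$ vertices. The fan $F_n$ is the graph $K_1+nK_2$, i.e. $n$ disjoint edges together with one additional vertex joined to all $2n$ endpoints of these edges (so $F_n$ has $2n+1$ vertices and consists of $n$ triangles sharing exactly one common vertex). -}

module Defs where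

open import Data.Nat using (ℕ; zero; suc; _+_; _*_; _≤_; _≡ᵇ_; _<ᵇ_)
open import Data.Nat.Properties using (≡ᵇ⇒≡)
open import Data.Bool using (Bool; true; false; _∧_; _∨_; not; if_then_else_)
open import Data.Bool.Properties using (∨-comm)
open import Data.Fin using (Fin; toℕ)
open import Data.List using (List; map; allFin)
open import Data.Nat.ListAction using (sum)
open import Data.Product using (Σ; ∃; ∃-syntax; _×_; _,_)
open import Data.Sum using (_⊎_)
open import Function.Definitions using (Injective)
open import Relation.Binary.PropositionalEquality using (_≡_; refl; cong₂)

record Graph (n : ℕ) : Set where
  field
    adj    : Fin n → Fin n → Bool
    sym    : ∀ i j → adj i j ≡ adj j i
    irrefl : ∀ i → adj i i ≡ false
open Graph public

edgeCount : ∀ {n} → Graph n → ℕ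
edgeCount {n} G =
  sum (map (λ i → sum (map (λ j → if adj G i j ∧ (toℕ i <ᵇ toℕ j) then 1 else 0)
                             (allFin n)))
           (allFin n))

-- A red/blue colouring of the edges (true = red, false = blue).
-- Represented by a symmetric function; values on non-edges are irrelevant.
Colouring : ℕ → Set
Colouring n = Σ (Fin n → Fin n → Bool) (λ c → ∀ i j → c i j ≡ c j i)

HasColouredCopy : ∀ {n h} → Graph n → Colouring n → Bool → Graph h → Set
HasColouredCopy G (c , _) col H =
  ∃[ f ] (Injective _≡_ _≡_ f ×
          (∀ a b → adj H a b ≡ true →
                   adj G (f a) (f b) ≡ true × c (f a) (f b) ≡ col))

Arrows : ∀ {n h₁ h₂} → Graph n → Graph h₁ → Graph h₂ → Set
Arrows {n} G H₁ H₂ =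
  (c : Colouring n) → HasColouredCopy G c true H₁ ⊎ HasColouredCopy G c false H₂

IsSizeRamsey : ∀ {h₁ h₂} → Graph h₁ → Graph h₂ → ℕ → Set
IsSizeRamsey H₁ H₂ m =
  (∃[ n ] Σ (Graph n) (λ G → edgeCount G ≡ m × Arrows G H₁ H₂)) ×
  (∀ n (G : Graph n) → Arrows G H₁ H₂ → m ≤ edgeCount G)

-- vertices 0,1,2; edges {0,1},{1,2}: i.e. exactly one endpoint is 1
p3adj : ℕ → ℕ → Bool
p3adj a b = ((a ≡ᵇ 1) ∧ not (b ≡ᵇ 1) ∨ (b ≡ᵇ 1) ∧ not (a ≡ᵇ 1))

p3sym : ∀ a b → p3adj a b ≡ p3adj b a
p3sym a b with a ≡ᵇ 1 | b ≡ᵇ 1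
... | true  | true  = refl
... | true  | false = refl
... | false | true  = refl
... | false | false = refl

p3irr : ∀ a → p3adj a a ≡ false
p3irr a with a ≡ᵇ 1
... | true = refl
... | false = refl

P₃ : Graph 3
P₃ = record { adj = λ i j → p3adj (toℕ i) (toℕ j)
            ; sym = λ i j → p3sym (toℕ i) (toℕ j)
            ; irrefl = λ i → p3irr (toℕ i) }

-- Fan F_n = K₁ + nK₂ on vertices 0,…,2n : centre 0, triangles {0, 2k+1, 2k+2}

isOdd : ℕ → Bool
isOdd zero = false
isOdd (suc n) = not (isOdd n)

paired : ℕ → ℕ → Bool
paired a b = (isOdd a ∧ (b ≡ᵇ suc a)) ∨ (isOdd b ∧ (a ≡ᵇ suc b))

fanAdj : ℕ → ℕ → Bool
fanAdj a b = ((a ≡ᵇ 0) ∧ not (b ≡ᵇ 0)) ∨ ((b ≡ᵇ 0) ∧ not (a ≡ᵇ 0)) ∨ paired a b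

fanSym : ∀ a b → fanAdj a b ≡ fanAdj b a
fanSym a b with a ≡ᵇ 0 | b ≡ᵇ 0
... | true  | true  = ∨-comm (isOdd a ∧ (b ≡ᵇ suc a)) (isOdd b ∧ (a ≡ᵇ suc b))
... | true  | false = refl
... | false | true  = refl
... | false | false = ∨-comm (isOdd a ∧ (b ≡ᵇ suc a)) (isOdd b ∧ (a ≡ᵇ suc b))

≡ᵇ-suc : ∀ a → (a ≡ᵇ suc a) ≡ false
≡ᵇ-suc zero = refl
≡ᵇ-suc (suc a) = ≡ᵇ-suc a

∧-false : ∀ x → (x ∧ false) ≡ false
∧-false true = refl
∧-false false = refl

fanIrr : ∀ a → fanAdj a a ≡ false
fanIrr a with a ≡ᵇ 0
... | true  rewrite ≡ᵇ-suc a | ∧-false (isOdd a) = refl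
... | false rewrite ≡ᵇ-suc a | ∧-false (isOdd a) = refl

Fan : (n : ℕ) → Graph (suc (2 * n))
Fan n = record { adj = λ i j → fanAdj (toℕ i) (toℕ j)
               ; sym = λ i j → fanSym (toℕ i) (toℕ j)
               ; irrefl = λ i → fanIrr (toℕ i) }

{-# OPTIONS --safe #-}

-- G arrows (P₃, F_n) iff G minus any matching still contains F_n.
--
-- Upper bound: for n odd take a vertex c joined to everything in (n+1)/2 disjoint 4-cycles, for n
-- even to n/2 four-cycles and a path P₃.  Below c any matching leaves n + 1 disjoint edges, and a
-- deleted spoke costs at most one of them.  For n = 2 the graph K₅ is better.
--
-- Lower bound: if only c has degree at least 2n, consider the graph H induced on its neighbours.
-- After deleting a vertex v and any matching, H retains n disjoint edges, and one shows
-- |V(H)| + |E(H)| ≥ 4n + 4: each unit of matching number is worth 4, because deleting a vertex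
-- of degree at least 3, or a leaf with its neighbour, destroys at most one matching edge at cost
-- at least 4, while a 2-regular graph has 2|V| = |V| + |E| ≥ 4ν.  Tightness forces disjoint
-- 4-cycles, hence n odd.  Two vertices of degree at least 2n force 6n - 1 edges and three force
-- 6n - 2, which suffices for n ≥ 2; for n = 1 there is a direct argument about triangles.
module Submission where

open import Defs
open import Data.Nat
open import Data.Nat.Properties
open import Data.Nat.Tactic.RingSolver using (solve-∀)
open import Data.Bool as Bool using (Bool; true; false; _∧_; _∨_; if_then_else_)
open import Data.Bool.Properties using (∧-identityʳ; ∧-zeroʳ; not-involutive)
open import Data.Empty using (⊥; ⊥-elim)
open import Data.Fin as Fin using (Fin; toℕ)
open import Data.Fin.Patterns using (0F; 1F; 2F; 3F; 4F)
import Data.Fin.Properties as Fin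
import Data.List.Membership.DecPropositional as DecMembership
open import Data.List using (List; []; _∷_; map; length; filter; allFin; tabulate)
open import Data.List.Properties using (map-tabulate; length-map; length-tabulate)
open import Data.List.Membership.Propositional using (_∈_; _∉_)
open import Data.List.Membership.Propositional.Properties using (∈-∃++; ∈-allFin; ∈-filter⁺; ∈-filter⁻)
open import Data.List.Relation.Binary.Permutation.Propositional using (_↭_; refl; prep; swap; trans; ↭-sym)
open import Data.List.Relation.Binary.Permutation.Propositional.Properties using (∈-resp-↭; All-resp-↭; ↭-length; shift)
open import Data.List.Relation.Unary.All as All using (All; []; _∷_)
import Data.List.Relation.Unary.All.Properties as All
open import Data.List.Relation.Unary.AllPairs using (AllPairs; []; _∷_)
import Data.List.Relation.Unary.AllPairs.Properties as AllPairs
open import Data.List.Relation.Unary.Any using (here; there)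
open import Data.List.Relation.Unary.Unique.Propositional using (Unique)
import Data.List.Relation.Unary.Unique.Propositional.Properties as Unique
open import Data.Nat.ListAction using (sum)
open import Data.Product using (Σ; ∃₂; ∃-syntax; _×_; _,_; proj₁; proj₂; uncurry)
open import Data.Sum using (_⊎_; inj₁; inj₂)
open import Function using (id; _∘_; case_of_)
open import Function.Definitions using (Injective)
open import Relation.Binary.PropositionalEquality as ≡ using (_≡_; _≢_; refl; cong; cong₂; subst)
open import Relation.Nullary using (¬_; Dec; yes; no; contradiction; ⌊_⌋)
open import Relation.Nullary.Decidable as Dec using (_×-dec_; ¬?)

-- A red edge set without `P₃` is a matching, so the lower bound quantifies over matchings only.
-- Subgraphs are lists of vertices of one fixed graph, taken up to permutation: deleting a vertex is
-- dropping the head of a list, and no induced graph is ever built. The constant 4n + 4 is 4n for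
-- the neighbourhood of the centre after one vertex is gone, plus 4 for that vertex; it may be
-- deleted because the spoke to it can be red. Parity comes from the equality case of the bound 4n,
-- and there the induction must carry a second conclusion, that exactly 2n vertices remain: with
-- only one vertex more there is no room for n + 1 disjoint edges. The bounds 6n - 2 and 4n + 4
-- agree at n = 3. At n = 2 the former, 10, is smaller, and `K₅`, in which every vertex has degree
-- 2n, attains it; at n = 1 it would give only 4, hence the separate argument.

private
  variable
    A : Set

-- Lists without repetition, up to permutation

Unique-resp-↭ : ∀ {xs ys : List A} → xs ↭ ys → Unique xs → Unique ys
Unique-resp-↭ refl u = u
Unique-resp-↭ (prep x p) (a ∷ u) = All-resp-↭ p a ∷ Unique-resp-↭ p u
Unique-resp-↭ (swap x y p) ((x≢y ∷ a) ∷ b ∷ u) =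
  (x≢y ∘ ≡.sym ∷ All-resp-↭ p b) ∷ All-resp-↭ p a ∷ Unique-resp-↭ p u
Unique-resp-↭ (trans p q) u = Unique-resp-↭ q (Unique-resp-↭ p u)

Unique-tail : ∀ {x : A} {xs} → Unique (x ∷ xs) → Unique xs
Unique-tail (_ ∷ u) = u

-- Any chosen vertex can be brought to the front; since degrees, edge counts and robustness are
-- invariant under permutation, recursion on lists can delete an arbitrary vertex.
∈⇒↭ : ∀ {x : A} {xs} → x ∈ xs → ∃[ ys ] xs ↭ x ∷ ys
∈⇒↭ {x = x} x∈xs with ys , zs , refl ← ∈-∃++ x∈xs = _ , shift x ys zs

∉-head : ∀ {x : A} {xs} → Unique (x ∷ xs) → x ∉ xs
∉-head (a ∷ _) x∈xs = All.lookup a x∈xs refl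

∈-tail : ∀ {x y : A} {xs} → y ∈ x ∷ xs → y ≢ x → y ∈ xs
∈-tail (here y≡x) y≢x = contradiction y≡x y≢x
∈-tail (there y∈xs) _ = y∈xs

Unique-⊆⇒length≤ : ∀ {xs ys : List A} → Unique xs → (∀ {x} → x ∈ xs → x ∈ ys) → length xs ≤ length ys
Unique-⊆⇒length≤ [] _ = z≤n
Unique-⊆⇒length≤ {xs = x ∷ xs} (a ∷ u) xs⊆ys with zs , ys↭ ← ∈⇒↭ (xs⊆ys (here refl)) =
  ≤-trans
    (s≤s (Unique-⊆⇒length≤ u λ z∈xs → ∈-tail (∈-resp-↭ ys↭ (xs⊆ys (there z∈xs))) (All.lookup a z∈xs ∘ ≡.sym)))
    (≤-reflexive (≡.sym (↭-length ys↭)))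

any-or-all : ∀ {P Q : A → Set} → (∀ x → P x ⊎ Q x) → ∀ xs → (∃[ x ] x ∈ xs × P x) ⊎ All Q xs
any-or-all d [] = inj₂ []
any-or-all d (x ∷ xs) with d x | any-or-all d xs
... | inj₁ p | _ = inj₁ (x , here refl , p)
... | inj₂ _ | inj₁ (y , y∈xs , p) = inj₁ (y , there y∈xs , p)
... | inj₂ q | inj₂ qs = inj₂ (q ∷ qs)

-- Degrees and edge counts along a list of vertices

⟦_⟧ : Bool → ℕ
⟦ b ⟧ = if b then 1 else 0

⟦⟧≤1 : ∀ b → ⟦ b ⟧ ≤ 1
⟦⟧≤1 true = s≤s z≤n
⟦⟧≤1 false = z≤n

true≢false : true ≢ false
true≢false ()

≢true⇒≡false : ∀ {b} → b ≢ true → b ≡ false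
≢true⇒≡false {true} b≢ = contradiction refl b≢
≢true⇒≡false {false} _ = refl

degIn : (A → A → Bool) → A → List A → ℕ
degIn R x [] = 0
degIn R x (y ∷ ys) = ⟦ R x y ⟧ + degIn R x ys

edgesIn : (A → A → Bool) → List A → ℕ
edgesIn R [] = 0
edgesIn R (x ∷ xs) = degIn R x xs + edgesIn R xs

module _ {n} (G : Graph n) where

  private
    up : Fin n → Fin n → ℕ
    up i j = ⟦ adj G i j ∧ (toℕ i <ᵇ toℕ j) ⟧

    <ᵇ-true : ∀ {i j} → i < j → (i <ᵇ j) ≡ true
    <ᵇ-true {i} {j} i<j with i <ᵇ j | <⇒<ᵇ i<j
    ... | true | _ = refl

    <ᵇ-false : ∀ {i j} → j ≤ i → (i <ᵇ j) ≡ false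
    <ᵇ-false {i} {j} j≤i with i <ᵇ j in eq
    ... | false = refl
    ... | true = contradiction (<ᵇ⇒< i j (subst Bool.T (≡.sym eq) _)) (≤⇒≯ j≤i)

    up≡adj : ∀ {i j} → i Fin.< j → up i j ≡ ⟦ adj G i j ⟧
    up≡adj i<j rewrite <ᵇ-true i<j = cong ⟦_⟧ (∧-identityʳ _)

    up≡0 : ∀ {i j} → j Fin.≤ i → up i j ≡ 0
    up≡0 {i} {j} j≤i rewrite <ᵇ-false j≤i = cong ⟦_⟧ (∧-zeroʳ (adj G i j))

    row : ∀ {x xs} → All (x Fin.<_) xs → sum (map (up x) xs) ≡ degIn (adj G) x xs
    row [] = refl
    row (x<y ∷ a) = cong₂ _+_ (up≡adj x<y) (row a)

    column : ∀ {x ys} zs → All (x Fin.<_) ys →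
      sum (map (λ i → sum (map (up i) (x ∷ zs))) ys) ≡ sum (map (λ i → sum (map (up i) zs)) ys)
    column zs [] = refl
    column zs (x<y ∷ a) = cong₂ _+_ (cong (_+ _) (up≡0 (<⇒≤ x<y))) (column zs a)

    -- In a sorted list the terms on and below the diagonal vanish: the head contributes its row to
    -- the right, and its column adds nothing to the later rows. This turns the double sum of
    -- `edgeCount` into a recursion on lists.
    triangular : ∀ {xs} → AllPairs Fin._<_ xs → sum (map (λ i → sum (map (up i) xs)) xs) ≡ edgesIn (adj G) xs
    triangular [] = refl
    triangular {x ∷ xs} (a ∷ p) =
      cong₂ _+_ (cong₂ _+_ (up≡0 {x} ≤-refl) (row a)) (≡.trans (column xs a) (triangular p))

  edgeCount≡edgesIn : edgeCount G ≡ edgesIn (adj G) (allFin n)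
  edgeCount≡edgesIn = triangular (AllPairs.tabulate⁺-< id)

-- Matchings as lists of pairs

verts : List (A × A) → List A
verts [] = []
verts ((a , b) ∷ L) = a ∷ b ∷ verts L

-- The relation `R` is left open so that one notion serves for blue edges, for edges avoiding a
-- vertex, and for blue triangles over a fixed centre; in the last case a matching is the rim of a
-- fan.
record IsMatching {A : Set} (R : A → A → Set) (L : List (A × A)) : Set where
  constructor _,_
  field
    disjoint : Unique (verts L)
    edges    : All (uncurry R) L

length-verts : (L : List (A × A)) → length (verts L) ≡ 2 * length L
length-verts [] = refl
length-verts (_ ∷ L) rewrite length-verts L = eq (length L)
  where
  eq : ∀ l → suc (suc (2 * l)) ≡ 2 * suc l
  eq = solve-∀

mapMatching : ∀ {R S : A → A → Set} {L} → (∀ {a b} → R a b → S a b) → IsMatching R L → IsMatching S L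
mapMatching f (u , es) = u , All.map f es

All-verts : ∀ {R : A → A → Set} {P : A → Set} {L} → (∀ {a b} → R a b → P a × P b) → All (uncurry R) L → All P (verts L)
All-verts f [] = []
All-verts f (r ∷ rs) = proj₁ (f r) ∷ proj₂ (f r) ∷ All-verts f rs

matching-bound : ∀ {R : A → A → Set} {xs L} → (∀ {a b} → R a b → a ∈ xs × b ∈ xs) → IsMatching R L → 2 * length L ≤ length xs
matching-bound {L = L} f (u , es) = subst (_≤ _) (length-verts L) (Unique-⊆⇒length≤ u (All.lookup (All-verts f es)))

module _ {n : ℕ} {R : Fin n → Fin n → Set} (v : Fin n) where

  Avoiding : Fin n → Fin n → Set
  Avoiding a b = R a b × a ≢ v × b ≢ v

  private
    avoid : ∀ {L} → All (v ≢_) (verts L) → All (uncurry R) L → All (uncurry Avoiding) L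
    avoid [] [] = []
    avoid {_ ∷ _} (p ∷ q ∷ ps) (r ∷ rs) = (r , p ∘ ≡.sym , q ∘ ≡.sym) ∷ avoid ps rs

    -- Every edge that is kept uses only vertices of the original list, so disjointness survives.
    go : ∀ L → IsMatching R L →
      ∃[ L′ ] IsMatching Avoiding L′ × length L ≤ suc (length L′) × (∀ {P : Fin n → Set} → All P (verts L) → All P (verts L′))
    go [] _ = [] , ([] , []) , z≤n , id
    go ((a , b) ∷ L) (((a≢b ∷ a∉) ∷ b∉ ∷ u) , (r ∷ rs)) with a Fin.≟ v | b Fin.≟ v
    ... | yes refl | _ = L , (u , avoid a∉ rs) , ≤-refl , λ { (_ ∷ _ ∷ ps) → ps }
    ... | no _ | yes refl = L , (u , avoid b∉ rs) , ≤-refl , λ { (_ ∷ _ ∷ ps) → ps }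
    ... | no a≢v | no b≢v with L′ , (u′ , rs′) , le , keep ← go L (u , rs) =
      (a , b) ∷ L′ , ((a≢b ∷ keep a∉) ∷ keep b∉ ∷ u′ , (r , a≢v , b≢v) ∷ rs′) , s≤s le ,
      λ { (p ∷ q ∷ ps) → p ∷ q ∷ keep ps }

  remove : ∀ {L} → IsMatching R L → ∃[ L′ ] IsMatching Avoiding L′ × length L ≤ suc (length L′)
  remove {L} M with L′ , M′ , le , _ ← go L M = L′ , M′ , le

-- Red matchings, blue edges and robust vertex sets

module Colourings {N : ℕ} (G : Graph N) where

  V : Set
  V = Fin N

  _~_ : V → V → Set
  x ~ y = adj G x y ≡ true

  deg : V → List V → ℕ
  deg = degIn (adj G)

  E : List V → ℕ
  E = edgesIn (adj G)

  -- When `xs` is the neighbourhood of a vertex, this counts the spokes together with the edges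
  -- among the neighbours.
  cost : List V → ℕ
  cost xs = length xs + E xs

  ~-sym : ∀ {x y} → x ~ y → y ~ x
  ~-sym {x} {y} x~y = ≡.trans (sym G y x) x~y

  ~⇒≢ : ∀ {x y} → x ~ y → x ≢ y
  ~⇒≢ {x} x~y refl = true≢false (≡.trans (≡.sym x~y) (irrefl G x))

  deg-↭ : ∀ x {xs ys} → xs ↭ ys → deg x xs ≡ deg x ys
  deg-↭ x refl = refl
  deg-↭ x (prep y p) = cong (⟦ adj G x y ⟧ +_) (deg-↭ x p)
  deg-↭ x (swap {xs} {ys} y z p) rewrite deg-↭ x p = swap+ ⟦ adj G x y ⟧ ⟦ adj G x z ⟧ (deg x ys)
    where
    swap+ : ∀ a b c → a + (b + c) ≡ b + (a + c)
    swap+ = solve-∀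
  deg-↭ x (trans p q) = ≡.trans (deg-↭ x p) (deg-↭ x q)

  E-↭ : ∀ {xs ys} → xs ↭ ys → E xs ≡ E ys
  E-↭ refl = refl
  E-↭ (prep x p) = cong₂ _+_ (deg-↭ x p) (E-↭ p)
  E-↭ (swap {xs} {ys} x y p) rewrite deg-↭ x p | deg-↭ y p | E-↭ p | sym G y x =
    swap+ ⟦ adj G x y ⟧ (deg x ys) (deg y ys) (E ys)
    where
    swap+ : ∀ a b c d → a + b + (c + d) ≡ a + c + (b + d)
    swap+ = solve-∀
  E-↭ (trans p q) = ≡.trans (E-↭ p) (E-↭ q)

  cost-↭ : ∀ {xs ys} → xs ↭ ys → cost xs ≡ cost ys
  cost-↭ p = cong₂ _+_ (↭-length p) (E-↭ p)

  deg-self : ∀ x xs → deg x (x ∷ xs) ≡ deg x xs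
  deg-self x xs rewrite irrefl G x = refl

  deg-head : ∀ {x xs ys} → xs ↭ x ∷ ys → deg x xs ≡ deg x ys
  deg-head {x} {ys = ys} p = ≡.trans (deg-↭ x p) (deg-self x ys)

  deg-~ : ∀ {x y} ys → x ~ y → deg x (y ∷ ys) ≡ suc (deg x ys)
  deg-~ ys x~y rewrite x~y = refl

  deg≡0⇒≁ : ∀ {x y ys} → deg x ys ≡ 0 → y ∈ ys → ¬ x ~ y
  deg≡0⇒≁ {ys = _ ∷ ys} eq (here refl) x~y rewrite x~y = case eq of λ ()
  deg≡0⇒≁ {x} {ys = y′ ∷ _} eq (there y∈ys) = deg≡0⇒≁ (m+n≡0⇒n≡0 ⟦ adj G x y′ ⟧ eq) y∈ys

  neighbour : ∀ {x k} ys → deg x ys ≡ suc k → ∃₂ λ y zs → ys ↭ y ∷ zs × x ~ y × deg x zs ≡ k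
  neighbour {x} (y ∷ ys) eq with adj G x y in x~y
  ... | true = y , ys , refl , x~y , suc-injective eq
  ... | false with z , zs , p , x~z , eq′ ← neighbour ys eq =
    z , y ∷ zs , trans (prep y p) (swap y z refl) , x~z , ≡.trans (cong (λ b → ⟦ b ⟧ + deg x zs) x~y) eq′

  sumDeg : List V → List V → ℕ
  sumDeg xs zs = sum (map (λ x → deg x zs) xs)

  sumDeg-∷ : ∀ x xs zs → sumDeg xs (x ∷ zs) ≡ deg x xs + sumDeg xs zs
  sumDeg-∷ x [] zs = refl
  sumDeg-∷ x (y ∷ xs) zs rewrite sumDeg-∷ x xs zs | sym G y x =
    eq ⟦ adj G x y ⟧ (deg y zs) (deg x xs) (sumDeg xs zs)
    where
    eq : ∀ a b c d → a + b + (c + d) ≡ a + c + (b + d)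
    eq = solve-∀

  handshake : ∀ xs → sumDeg xs xs ≡ 2 * E xs
  handshake [] = refl
  handshake (x ∷ xs) rewrite irrefl G x | sumDeg-∷ x xs xs | handshake xs = eq (deg x xs) (E xs)
    where
    eq : ∀ a b → a + (a + 2 * b) ≡ 2 * (a + b)
    eq = solve-∀

  sumDeg-≥ : ∀ {k xs zs} → All (λ x → k ≤ deg x zs) xs → k * length xs ≤ sumDeg xs zs
  sumDeg-≥ {k} [] = ≤-reflexive (*-zeroʳ k)
  sumDeg-≥ {k} {_ ∷ xs} {zs} (d ∷ ds) = ≤-trans (≤-reflexive (*-suc k (length xs))) (+-mono-≤ d (sumDeg-≥ {k} {xs} {zs} ds))

  sumDeg-≡ : ∀ {k xs zs} → All (λ x → deg x zs ≡ k) xs → sumDeg xs zs ≡ k * length xs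
  sumDeg-≡ {k} [] = ≡.sym (*-zeroʳ k)
  sumDeg-≡ {k} {_ ∷ xs} {zs} (d ∷ ds) = ≡.trans (cong₂ _+_ d (sumDeg-≡ {k} {xs} {zs} ds)) (≡.sym (*-suc k (length xs)))

  -- A matching is encoded as the involution exchanging the ends of its edges and fixing
  -- all other vertices; the pairs need not be edges of G.
  record Involution (xs : List V) : Set where
    field
      ι         : V → V
      involutive : ∀ z → ι (ι z) ≡ z
      fixes     : ∀ {z} → z ∉ xs → ι z ≡ z
  open Involution public

  identity : ∀ {xs} → Involution xs
  identity = record { ι = id ; involutive = λ _ → refl ; fixes = λ _ → refl }

  weaken : ∀ {xs ys} → (∀ {z} → z ∈ xs → z ∈ ys) → Involution xs → Involution ys
  weaken xs⊆ys m = record { ι = ι m ; involutive = involutive m ; fixes = λ z∉ys → fixes m (z∉ys ∘ xs⊆ys) }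

  module Pairing (x y : V) {zs : List V} (u : Unique (x ∷ y ∷ zs)) (m : Involution zs) where
    private
      x≢y : x ≢ y
      x≢y = All.lookup (case u of λ { (a ∷ _) → a }) (here refl)

      ιx : ι m x ≡ x
      ιx = fixes m (∉-head u ∘ there)

      ιy : ι m y ≡ y
      ιy = fixes m (∉-head (case u of λ { (_ ∷ v) → v }))

      f : V → V
      f z with z Fin.≟ x | z Fin.≟ y
      ... | yes _ | _ = y
      ... | no _ | yes _ = x
      ... | no _ | no _ = ι m z

      fx : f x ≡ y
      fx with x Fin.≟ x
      ... | yes _ = refl
      ... | no x≢x = contradiction refl x≢x

      fy : f y ≡ x
      fy with y Fin.≟ x | y Fin.≟ y
      ... | yes y≡x | _ = contradiction (≡.sym y≡x) x≢y
      ... | no _ | yes _ = refl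
      ... | no _ | no y≢y = contradiction refl y≢y

      fz : ∀ {z} → z ≢ x → z ≢ y → f z ≡ ι m z
      fz {z} z≢x z≢y with z Fin.≟ x | z Fin.≟ y
      ... | yes z≡x | _ = contradiction z≡x z≢x
      ... | no _ | yes z≡y = contradiction z≡y z≢y
      ... | no _ | no _ = refl

      moved : ∀ {w z} → ι m w ≡ w → z ≢ w → ι m z ≢ w
      moved {w} {z} ιw z≢w eq = z≢w (≡.trans (≡.sym (involutive m z)) (≡.trans (cong (ι m) eq) ιw))

    -- As `m` is supported on `zs`, it fixes `x` and `y`, so exchanging these two does not interfere
    -- with it.
    pair : Involution (x ∷ y ∷ zs)
    ι pair = f
    involutive pair z with z Fin.≟ x | z Fin.≟ y
    ... | yes refl | _ = fy
    ... | no _ | yes refl = fx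
    ... | no z≢x | no z≢y = ≡.trans (fz (moved ιx z≢x) (moved ιy z≢y)) (involutive m z)
    fixes pair z∉ =
      ≡.trans (fz (z∉ ∘ here) (z∉ ∘ there ∘ here)) (fixes m (z∉ ∘ there ∘ there))

    pair-x : ι pair x ≡ y
    pair-x = fx

    pair-y : ι pair y ≡ x
    pair-y = fy

    pair-z : ∀ {z} → z ≢ x → z ≢ y → ι pair z ≡ ι m z
    pair-z = fz

  open Pairing public

  record Blue (f : V → V) (xs : List V) (a b : V) : Set where
    constructor mkBlue
    field
      left∈  : a ∈ xs
      right∈ : b ∈ xs
      edge   : a ~ b
      notRed : f a ≢ b

  Blue⇒∈ : ∀ {f xs a b} → Blue f xs a b → a ∈ xs × b ∈ xs
  Blue⇒∈ (mkBlue a∈ b∈ _ _) = a∈ , b∈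

  Robust : ℕ → List V → Set
  Robust r xs = (m : Involution xs) → ∃[ L ] IsMatching (Blue (ι m) xs) L × r ≤ length L

  Robust-↭ : ∀ {r xs ys} → xs ↭ ys → Robust r xs → Robust r ys
  Robust-↭ p rob m with L , M , le ← rob (weaken (∈-resp-↭ (↭-sym p)) m) =
    L , mapMatching (λ { (mkBlue a∈ b∈ e red) → mkBlue (∈-resp-↭ p a∈) (∈-resp-↭ p b∈) e red }) M , le

  -- Isolated in the blue graph: `x` has at most one neighbour in `xs`, and the edge to it is red.
  Isolated : (V → V) → List V → V → Set
  Isolated f xs x = ∀ {u} → u ∈ xs → x ~ u → f x ≡ u

  isolated-avoided : ∀ {xs x a b} (m : Involution xs) → Isolated (ι m) xs x → Blue (ι m) xs a b → a ≢ x × b ≢ x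
  isolated-avoided m iso (mkBlue a∈ b∈ a~b blue) =
    (λ { refl → blue (iso b∈ a~b) }) ,
    (λ { refl → blue (≡.trans (cong (ι m) (≡.sym (iso a∈ (~-sym a~b)))) (involutive m _)) })

  Blue-tail : ∀ {f v ys a b} → Blue f (v ∷ ys) a b → a ≢ v → b ≢ v → Blue f ys a b
  Blue-tail (mkBlue a∈ b∈ e red) a≢v b≢v = mkBlue (∈-tail a∈ a≢v) (∈-tail b∈ b≢v) e red

  Robust-delete : ∀ {r v ys} → Robust (suc r) (v ∷ ys) → Robust r ys
  Robust-delete {v = v} rob m
    with L , M , le ← rob (weaken there m)
    with L′ , M′ , le′ ← remove v M =
    L′ , mapMatching (λ { (blue , a≢v , b≢v) → Blue-tail blue a≢v b≢v }) M′ , ≤-pred (≤-trans le le′)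

  Robust-isolated : ∀ {r x ys} → deg x ys ≡ 0 → Robust r (x ∷ ys) → Robust r ys
  Robust-isolated {x = x} {ys} d rob m with L , M , le ← rob (weaken there m) =
    L , mapMatching (λ blue → uncurry (Blue-tail blue) (isolated-avoided (weaken there m) iso blue)) M , le
    where
    iso : Isolated (ι m) (x ∷ ys) x
    iso (here refl) x~x = contradiction refl (~⇒≢ x~x)
    iso (there u∈) x~u = contradiction x~u (deg≡0⇒≁ d u∈)

  -- The hypothesis is applied to a red matching that contains xy.
  Robust-pair : ∀ {r x y zs} → Unique (x ∷ y ∷ zs) → deg x zs ≡ 0 → deg y zs ≡ 0 → Robust r (x ∷ y ∷ zs) → Robust r zs
  Robust-pair {x = x} {y} {zs} u dx dy rob m with L , M , le ← rob (pair x y u m) =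
    L , mapMatching blue′ M , le
    where
    isox : Isolated (ι (pair x y u m)) (x ∷ y ∷ zs) x
    isox (here refl) e = contradiction refl (~⇒≢ e)
    isox (there (here refl)) e = pair-x x y u m
    isox (there (there u∈)) e = contradiction e (deg≡0⇒≁ dx u∈)
    isoy : Isolated (ι (pair x y u m)) (x ∷ y ∷ zs) y
    isoy (here refl) e = pair-y x y u m
    isoy (there (here refl)) e = contradiction refl (~⇒≢ e)
    isoy (there (there u∈)) e = contradiction e (deg≡0⇒≁ dy u∈)
    blue′ : ∀ {a b} → Blue (ι (pair x y u m)) (x ∷ y ∷ zs) a b → Blue (ι m) zs a b
    blue′ blue with a≢x , b≢x ← isolated-avoided (pair x y u m) isox blue
                  | a≢y , b≢y ← isolated-avoided (pair x y u m) isoy blue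
                  with mkBlue a∈ b∈ e red ← Blue-tail (Blue-tail blue a≢x b≢x) a≢y b≢y =
      mkBlue a∈ b∈ e λ eq → red (≡.trans (pair-z x y u m a≢x a≢y) eq)

  Robust-leaf : ∀ {r x y zs} → deg x zs ≡ 0 → Robust (suc r) (x ∷ y ∷ zs) → Robust r zs
  Robust-leaf d rob = Robust-isolated d (Robust-delete (Robust-↭ (swap _ _ refl) rob))

  Robust⇒2r≤length : ∀ {r xs} → Robust r xs → 2 * r ≤ length xs
  Robust⇒2r≤length rob with L , M , le ← rob identity =
    ≤-trans (*-monoʳ-≤ 2 le) (matching-bound Blue⇒∈ M)

  Robust-isolate⇒2r≤length : ∀ {r x zs} (m : Involution (x ∷ zs)) → Isolated (ι m) (x ∷ zs) x →
    Robust r (x ∷ zs) → 2 * r ≤ length zs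
  Robust-isolate⇒2r≤length m iso rob with L , M , le ← rob m =
    ≤-trans (*-monoʳ-≤ 2 le) (matching-bound
      (λ blue → Blue⇒∈ (uncurry (Blue-tail blue) (isolated-avoided m iso blue))) M)

  Robust-isolate₂⇒2r≤length : ∀ {r x y zs} (m : Involution (x ∷ y ∷ zs)) →
    Isolated (ι m) (x ∷ y ∷ zs) x → Isolated (ι m) (x ∷ y ∷ zs) y →
    Robust r (x ∷ y ∷ zs) → 2 * r ≤ length zs
  Robust-isolate₂⇒2r≤length {x = x} {y} {zs} m isox isoy rob with L , M , le ← rob m =
    ≤-trans (*-monoʳ-≤ 2 le) (matching-bound mem M)
    where
    mem : ∀ {a b} → Blue (ι m) (x ∷ y ∷ zs) a b → a ∈ zs × b ∈ zs
    mem blue with a≢x , b≢x ← isolated-avoided m isox blue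
                | a≢y , b≢y ← isolated-avoided m isoy blue
                = Blue⇒∈ (Blue-tail (Blue-tail blue a≢x b≢x) a≢y b≢y)

  -- Colouring the only possible edge at `x` red keeps the whole blue matching inside `zs`.
  Robust-deg≤1⇒2r≤length : ∀ {r x zs} → Unique (x ∷ zs) → deg x zs ≤ 1 → Robust r (x ∷ zs) → 2 * r ≤ length zs
  Robust-deg≤1⇒2r≤length {r} {x} {zs} u d rob with deg x zs in eq
  Robust-deg≤1⇒2r≤length {r} {x} {zs} u d rob | zero = Robust⇒2r≤length (Robust-isolated eq rob)
  Robust-deg≤1⇒2r≤length {r} {x} {zs} u d rob | suc (suc _) = contradiction d λ { (s≤s ()) }
  Robust-deg≤1⇒2r≤length {r} {x} {zs} u d rob | suc zero
    with y , ws , p , x~y , d′ ← neighbour zs eq =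
    subst (2 * r ≤_) (≡.sym (↭-length p))
      (Robust-isolate⇒2r≤length (pair x y u′ identity) iso (Robust-↭ (prep x p) rob))
    where
    u′ = Unique-resp-↭ (prep x p) u
    iso : Isolated (ι (pair x y u′ identity)) (x ∷ y ∷ ws) x
    iso (here refl) e = contradiction refl (~⇒≢ e)
    iso (there (here refl)) e = pair-x x y u′ identity
    iso (there (there u∈)) e = contradiction e (deg≡0⇒≁ d′ u∈)

-- Parity, and the arithmetic of one deletion

Even : ℕ → Set
Even n = ∃[ k ] n ≡ 2 * k

Even-suc² : ∀ {n} → Even n → Even (suc (suc n))
Even-suc² {n} (k , refl) = suc k , eq k
  where
  eq : ∀ k → suc (suc (2 * k)) ≡ 2 * suc k
  eq = solve-∀

Even-suc⇒¬Even : ∀ {n} → Even (suc n) → ¬ Even n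
Even-suc⇒¬Even (zero , ()) _
Even-suc⇒¬Even (suc j , p) (zero , refl) with () ← ≡.trans (suc-injective p) (+-suc j (j + 0))
Even-suc⇒¬Even (suc j , p) (suc k , refl) =
  Even-suc⇒¬Even (j , suc-injective (suc-injective (≡.trans (cong suc (≡.sym (eq k))) (≡.trans p (eq j))))) (k , refl)
  where
  eq : ∀ k → 2 * suc k ≡ suc (suc (2 * k))
  eq = solve-∀

4*suc≤ : ∀ {r c d} → 4 ≤ d → 4 * r ≤ c → 4 * suc r ≤ d + c
4*suc≤ {r} 4≤d 4r≤c = ≤-trans (≤-reflexive (*-suc 4 r)) (+-mono-≤ 4≤d 4r≤c)

-- Carries the equality case through a deletion of cost `d`: both the deleted part and the remainder
-- must be tight.
4*suc≡ : ∀ {r c d} → 4 ≤ d → 4 * r ≤ c → 4 * suc r ≡ d + c → 4 * r ≡ c × d ≡ 4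
4*suc≡ {r} {c} {d} 4≤d 4r≤c eq = tight (m≤n⇒m<n∨m≡n 4r≤c) (m≤n⇒m<n∨m≡n 4≤d)
  where
  eq′ : 4 + 4 * r ≡ d + c
  eq′ = ≡.trans (≡.sym (*-suc 4 r)) eq
  tight : 4 * r < c ⊎ 4 * r ≡ c → 4 < d ⊎ 4 ≡ d → 4 * r ≡ c × d ≡ 4
  tight (inj₁ lt) _ = contradiction eq′ (<⇒≢ (+-mono-≤-< 4≤d lt))
  tight (inj₂ _) (inj₁ lt) = contradiction eq′ (<⇒≢ (+-mono-<-≤ lt 4r≤c))
  tight (inj₂ e) (inj₂ e′) = e , ≡.sym e′

-- Degree 2 is set apart because it is the one degree at which no deletion pays off; if it occurs
-- everywhere, the graph is 2-regular.
classify-degree : ∀ d → (d ≡ 0 ⊎ d ≡ 1 ⊎ 3 ≤ d) ⊎ d ≡ 2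
classify-degree 0 = inj₁ (inj₁ refl)
classify-degree 1 = inj₁ (inj₂ (inj₁ refl))
classify-degree 2 = inj₂ refl
classify-degree (suc (suc (suc d))) = inj₁ (inj₂ (inj₂ (s≤s (s≤s (s≤s z≤n)))))

-- Lower bounds for robust vertex sets

module Bounds {N : ℕ} (G : Graph N) where
  open Colourings G

  cost-∷ : ∀ x xs → cost (x ∷ xs) ≡ suc (deg x xs) + cost xs
  cost-∷ x xs = eq (length xs) (deg x xs) (E xs)
    where
    eq : ∀ l d e → suc l + (d + e) ≡ suc d + (l + e)
    eq = solve-∀

  cost-∷∷ : ∀ x y zs → cost (x ∷ y ∷ zs) ≡ suc (deg x (y ∷ zs)) + suc (deg y zs) + cost zs
  cost-∷∷ x y zs rewrite cost-∷ x (y ∷ zs) | cost-∷ y zs = ≡.sym (+-assoc (suc (deg x (y ∷ zs))) (suc (deg y zs)) (cost zs))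

  -- An isolated edge can be coloured red and dropped without loss. Otherwise each unit of `r` pays
  -- for two edges: those at a vertex with at least two of them, or a leaf edge and a further edge
  -- at its end.
  Robust⇒2r≤E : ∀ {r} k xs → length xs ≤ k → Unique xs → Robust r xs → 2 * r ≤ E xs
  Robust⇒2r≤E {zero} _ _ _ _ _ = z≤n
  Robust⇒2r≤E {suc r} _ [] _ _ rob with () ← Robust⇒2r≤length rob
  Robust⇒2r≤E {suc r} (suc k) (x ∷ ys) (s≤s l) (x∉ys ∷ u) rob with deg x ys in dx
  ... | zero = Robust⇒2r≤E k ys l u (Robust-isolated dx rob)
  ... | suc (suc d) =
    ≤-trans (≤-reflexive (*-suc 2 r)) (+-mono-≤ (s≤s (s≤s (z≤n {d}))) (Robust⇒2r≤E k ys l u (Robust-delete rob)))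
  ... | suc zero
    with y , zs , p , x~y , dx′ ← neighbour ys dx
    with u′@(_ ∷ _ ∷ u″) ← Unique-resp-↭ (prep x p) (x∉ys ∷ u)
    with deg y zs in dy
  ...   | zero =
    m≤n⇒m≤1+n (≤-trans (Robust⇒2r≤E k zs l′ u″ (Robust-pair u′ dx′ dy (Robust-↭ (prep x p) rob)))
      (≤-reflexive (≡.trans (cong (_+ E zs) (≡.sym dy)) (≡.sym (E-↭ p)))))
    where
    l′ = ≤-trans (n≤1+n _) (≤-trans (≤-reflexive (≡.sym (↭-length p))) l)
  ...   | suc d =
    ≤-trans (≤-reflexive (*-suc 2 r))
      (s≤s (≤-trans (+-mono-≤ (s≤s (z≤n {d})) (Robust⇒2r≤E k zs l′ u″ (Robust-leaf dx′ (Robust-↭ (prep x p) rob))))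
        (≤-reflexive (≡.trans (cong (_+ E zs) (≡.sym dy)) (≡.sym (E-↭ p))))))
    where
    l′ = ≤-trans (n≤1+n _) (≤-trans (≤-reflexive (≡.sym (↭-length p))) l)

  regular⇒E≡length : ∀ {xs} → All (λ x → deg x xs ≡ 2) xs → E xs ≡ length xs
  regular⇒E≡length {xs} ds = *-cancelˡ-≡ (E xs) (length xs) 2 (≡.trans (≡.sym (handshake xs)) (sumDeg-≡ {2} {xs} {xs} ds))

  regular⇒cost : ∀ {xs} → All (λ x → deg x xs ≡ 2) xs → cost xs ≡ 2 * length xs
  regular⇒cost {xs} ds = cong (length xs +_) (≡.trans (regular⇒E≡length ds) (≡.sym (+-identityʳ _)))

  -- The cycle `c`, `b`, `a`, `d` split off as a component of a 2-regular graph, with `ws` the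
  -- remaining vertices.
  record FourCycle (c : V) (ys : List V) : Set where
    field
      b d a  : V
      ws     : List V
      perm   : ys ↭ b ∷ d ∷ a ∷ ws
      b≁d    : adj G b d ≡ false
      deg-b  : deg b ws ≡ 0
      deg-d  : deg d ws ≡ 0
      cost≡  : cost (c ∷ ys) ≡ 8 + cost ws

  -- The neighbours b and d of c are isolated in ys by the red edges joining each of them
  -- to its second neighbour, which is possible unless these second neighbours coincide.
  regular-structure : ∀ {c ys} → Unique (c ∷ ys) → All (λ x → deg x (c ∷ ys) ≡ 2) (c ∷ ys) →
    (∀ {r} → Robust r ys → 2 + 2 * r ≤ length ys) ⊎ FourCycle c ys
  regular-structure {c} {ys} (_ ∷ uys) (dc ∷ ds)
    with b , ys′ , p , c~b , dc′ ← neighbour ys (≡.trans (≡.sym (deg-self c ys)) dc)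
    with d , zs , p′ , c~d , dc″ ← neighbour ys′ dc′ = go
    where
    q : ys ↭ b ∷ d ∷ zs
    q = trans p (prep b p′)

    u : Unique (b ∷ d ∷ zs)
    u = Unique-resp-↭ q uys

    deg₂ : ∀ {x} → x ∈ b ∷ d ∷ zs → ⟦ adj G x c ⟧ + (⟦ adj G x b ⟧ + (⟦ adj G x d ⟧ + deg x zs)) ≡ 2
    deg₂ {x} x∈ = ≡.trans (≡.sym (deg-↭ x (prep c q))) (All.lookup ds (∈-resp-↭ (↭-sym q) x∈))

    deg-b : ⟦ adj G b d ⟧ + deg b zs ≡ 1
    deg-b with e ← deg₂ (here refl) rewrite ~-sym c~b | irrefl G b = suc-injective e

    deg-d : ⟦ adj G b d ⟧ + deg d zs ≡ 1
    deg-d with e ← deg₂ (there (here refl)) rewrite ~-sym c~d | irrefl G d | sym G d b = suc-injective e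

    go : (∀ {r} → Robust r ys → 2 + 2 * r ≤ length ys) ⊎ FourCycle c ys
    go with adj G b d in bd | deg-b | deg-d
    -- Here `c`, `b`, `d` form a triangle, so once `c` is gone the single red edge `bd` isolates
    -- both ends.
    ... | true | db | dd = inj₁ λ {r} rob →
      ≤-trans (s≤s (s≤s (Robust-isolate₂⇒2r≤length m isob isod (Robust-↭ q rob)))) (≤-reflexive (≡.sym (↭-length q)))
      where
      m = pair b d u identity
      isob : Isolated (ι m) (b ∷ d ∷ zs) b
      isob (here refl) e = contradiction refl (~⇒≢ e)
      isob (there (here refl)) e = pair-x b d u identity
      isob (there (there x∈)) e = contradiction e (deg≡0⇒≁ (suc-injective db) x∈)
      isod : Isolated (ι m) (b ∷ d ∷ zs) d
      isod (here refl) e = pair-y b d u identity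
      isod (there (here refl)) e = contradiction refl (~⇒≢ e)
      isod (there (there x∈)) e = contradiction e (deg≡0⇒≁ (suc-injective dd) x∈)
    ... | false | db | dd
      with a , ws , p₂ , b~a , db′ ← neighbour zs db
      with adj G d a in da
    ...   | true = inj₂ record
      { b = b ; d = d ; a = a ; ws = ws ; perm = q₂ ; b≁d = bd ; deg-b = db′ ; deg-d = dd′ ; cost≡ = cost≡ }
      where
      q₂ : ys ↭ b ∷ d ∷ a ∷ ws
      q₂ = trans q (prep b (prep d p₂))
      dd′ : deg d ws ≡ 0
      dd′ = suc-injective (≡.trans (cong (λ b → ⟦ b ⟧ + deg d ws) (≡.sym da)) (≡.trans (≡.sym (deg-↭ d p₂)) dd))
      ca : adj G c a ≡ false
      ca = ≢true⇒≡false (deg≡0⇒≁ dc″ (∈-resp-↭ (↭-sym p₂) (here refl)))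
      cws : deg c ws ≡ 0
      cws = m+n≡0⇒n≡0 ⟦ adj G c a ⟧ (≡.trans (≡.sym (deg-↭ c p₂)) dc″)
      aws : deg a ws ≡ 0
      aws with e ← deg₂ (there (there (∈-resp-↭ (↭-sym p₂) (here refl))))
        rewrite ≡.trans (sym G a c) ca | ~-sym b~a | ≡.trans (sym G a d) da | deg-↭ a p₂ | irrefl G a =
        suc-injective (suc-injective e)
      cost≡ : cost (c ∷ ys) ≡ 8 + cost ws
      cost≡ rewrite cost-↭ (prep c q₂) | c~b | c~d | ca | cws | bd | b~a | db′ | da | dd′ | aws =
        eq (length ws) (E ws)
        where
        eq : ∀ l e → 4 + l + (4 + e) ≡ 8 + (l + e)
        eq = solve-∀
    ...   | false
      with e , us , p₃ , d~e , dd′ ← neighbour ws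
             (≡.trans (cong (λ b → ⟦ b ⟧ + deg d ws) (≡.sym da)) (≡.trans (≡.sym (deg-↭ d p₂)) dd)) =
      inj₁ λ {r} rob →
        ≤-trans (s≤s (s≤s (Robust-isolate₂⇒2r≤length m isob isod (Robust-↭ q rob)))) (≤-reflexive (≡.sym (↭-length q)))
      where
      -- The second neighbours `a` of `b` and `d`'s own `e` are distinct, so `ba` and `de` can be
      -- red at once.
      s : b ∷ d ∷ zs ↭ b ∷ a ∷ d ∷ e ∷ us
      s = prep b (trans (prep d (trans p₂ (prep a p₃))) (swap d a refl))
      u′ : Unique (b ∷ a ∷ d ∷ e ∷ us)
      u′ = Unique-resp-↭ s u
      u″ : Unique (d ∷ e ∷ us)
      u″ with _ ∷ _ ∷ v ← u′ = v
      m₀ = pair d e u″ identity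
      m₁ = pair b a u′ m₀
      m : Involution (b ∷ d ∷ zs)
      m = weaken (∈-resp-↭ (↭-sym s)) m₁
      zs⊆ : ∀ {x} → x ∈ zs → x ∈ a ∷ e ∷ us
      zs⊆ = ∈-resp-↭ (trans p₂ (prep a p₃))
      isob : Isolated (ι m) (b ∷ d ∷ zs) b
      isob (here refl) g = contradiction refl (~⇒≢ g)
      isob (there (here refl)) g = contradiction (≡.trans (≡.sym g) bd) true≢false
      isob (there (there x∈)) g with ∈-resp-↭ p₂ x∈
      ... | here refl = pair-x b a u′ m₀
      ... | there x∈ws = contradiction g (deg≡0⇒≁ db′ x∈ws)
      d≢a : d ≢ a
      d≢a refl = ∉-head (case u′ of λ { (_ ∷ v) → v }) (here refl)
      d≢b : d ≢ b
      d≢b refl = ∉-head u′ (there (here refl))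
      isod : Isolated (ι m) (b ∷ d ∷ zs) d
      isod (here refl) g = contradiction (≡.trans (≡.sym (~-sym g)) bd) true≢false
      isod (there (here refl)) g = contradiction refl (~⇒≢ g)
      isod (there (there x∈)) g with zs⊆ x∈
      ... | here refl = contradiction (≡.trans (≡.sym g) da) true≢false
      ... | there (here refl) = ≡.trans (pair-z b a u′ m₀ d≢b d≢a) (pair-x d e u″ identity)
      ... | there (there x∈us) = contradiction g (deg≡0⇒≁ dd′ x∈us)

  -- The clause on the length serves the induction. If deleting a vertex of degree at least 3 were
  -- tight, 2r + 1 vertices would have to hold r + 1 disjoint edges. After a leaf is isolated by its
  -- red edge the count is the same.
  Tight : ℕ → List V → Set
  Tight r xs = 4 * r ≡ cost xs → Even r × length xs ≡ 2 * r

  -- The vertex `c` is already missing from `ys`. Deleting `a` costs at most one matching edge and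
  -- leaves `b` and `d` isolated.
  fourCycle-rest : ∀ {r c ys} (F : FourCycle c ys) → Robust (suc r) ys → Robust r (FourCycle.ws F)
  fourCycle-rest F rob =
    Robust-isolated deg-d (Robust-isolated (cong₂ _+_ (cong ⟦_⟧ b≁d) deg-b)
      (Robust-delete (Robust-↭ (trans perm (trans (prep b (swap d a refl)) (swap b a refl))) rob)))
    where open FourCycle F

  -- The bound `k` on the length lets the recursion follow arbitrary permutations. Equality survives
  -- only for `r` = 0 and in the 2-regular case, where four-cycles are peeled off, each lowering `r`
  -- by 2.
  Robust⇒4r≤cost : ∀ k xs → length xs ≤ k → Unique xs → ∀ r → Robust r xs → 4 * r ≤ cost xs × Tight r xs
  Robust⇒4r≤cost k xs l u zero rob = z≤n , λ eq → (0 , refl) , m+n≡0⇒m≡0 (length xs) (≡.sym eq)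
  Robust⇒4r≤cost k [] l u (suc r) rob with () ← Robust⇒2r≤length rob
  Robust⇒4r≤cost (suc k) xs@(x₀ ∷ xs₀) l u (suc r) rob with any-or-all (λ x → classify-degree (deg x xs)) xs
  ... | inj₁ (v , v∈ , inj₁ d≡0)
    with ys , p ← ∈⇒↭ v∈
    with _ ∷ uys ← Unique-resp-↭ p u
    with le , _ ← Robust⇒4r≤cost k ys (≤-pred (≤-trans (≤-reflexive (≡.sym (↭-length p))) l)) uys (suc r)
                    (Robust-isolated (≡.trans (≡.sym (deg-head p)) d≡0) (Robust-↭ p rob)) =
    <⇒≤ lt , λ eq → contradiction eq (<⇒≢ lt)
    where
    lt : 4 * suc r < cost xs
    lt = ≤-trans (s≤s (≤-trans le (m≤n+m (cost ys) (deg v ys)))) (≤-reflexive (≡.sym (≡.trans (cost-↭ p) (cost-∷ v ys))))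
  ... | inj₁ (v , v∈ , inj₂ (inj₂ 3≤d))
    with ys , p ← ∈⇒↭ v∈
    with _ ∷ uys ← Unique-resp-↭ p u
    with le , tight ← Robust⇒4r≤cost k ys (≤-pred (≤-trans (≤-reflexive (≡.sym (↭-length p))) l)) uys r
                        (Robust-delete (Robust-↭ p rob)) =
    ≤-trans (4*suc≤ 4≤ le) (≤-reflexive (≡.sym c≡)) , λ eq →
      contradiction
        (≤-trans (≤-reflexive (≡.sym (*-suc 2 r))) (≤-trans (Robust⇒2r≤length rob)
          (≤-reflexive (≡.trans (↭-length p) (cong suc (proj₂ (tight (proj₁ (4*suc≡ 4≤ le (≡.trans eq c≡)))))))))) 1+n≰n
    where
    c≡ : cost xs ≡ suc (deg v ys) + cost ys
    c≡ = ≡.trans (cost-↭ p) (cost-∷ v ys)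
    4≤ : 4 ≤ suc (deg v ys)
    4≤ = s≤s (≤-trans 3≤d (≤-reflexive (deg-head p)))
  ... | inj₁ (x , x∈ , inj₂ (inj₁ d≡1))
    with ys , p ← ∈⇒↭ x∈
    with y , zs , p′ , x~y , dx ← neighbour ys (≡.trans (≡.sym (deg-head p)) d≡1)
    with u′@(_ ∷ _ ∷ uzs) ← Unique-resp-↭ (trans p (prep x p′)) u = leaf
    where
    q : xs ↭ x ∷ y ∷ zs
    q = trans p (prep x p′)
    l′ : length zs ≤ k
    l′ = ≤-trans (n≤1+n _) (≤-pred (≤-trans (≤-reflexive (≡.sym (↭-length q))) l))
    c≡ : cost xs ≡ 3 + deg y zs + cost zs
    c≡ = ≡.trans (cost-↭ q) (≡.trans (cost-∷∷ x y zs)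
      (cong (λ d → suc d + suc (deg y zs) + cost zs) (≡.trans (deg-~ zs x~y) (cong suc dx))))
    leaf : 4 * suc r ≤ cost xs × Tight (suc r) xs
    leaf with deg y zs in dy
    -- An isolated edge, coloured red, is removed without lowering the matching number, though it
    -- costs 3; so the inequality is strict.
    ... | zero with le , _ ← Robust⇒4r≤cost k zs l′ uzs (suc r) (Robust-pair u′ dx dy (Robust-↭ q rob)) =
      <⇒≤ lt , λ eq → contradiction eq (<⇒≢ lt)
      where
      lt : 4 * suc r < cost xs
      lt = ≤-trans (s≤s (≤-trans le (m≤n+m (cost zs) 2))) (≤-reflexive (≡.sym (≡.trans c≡ (cong (λ d → 3 + d + cost zs) dy))))
    ... | suc d with le , tight ← Robust⇒4r≤cost k zs l′ uzs r (Robust-leaf dx (Robust-↭ q rob)) =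
      ≤-trans (4*suc≤ 4≤ le) (≤-reflexive (≡.sym c≡)) , λ eq →
        contradiction
          (≤-trans (≤-reflexive (≡.sym (*-suc 2 r)))
            (≤-trans (Robust-deg≤1⇒2r≤length u′ (≤-reflexive (≡.trans (deg-~ zs x~y) (cong suc dx))) (Robust-↭ q rob))
              (≤-reflexive (cong suc (proj₂ (tight (proj₁ (4*suc≡ 4≤ le (≡.trans eq c≡)))))))))
          1+n≰n
      where
      4≤ : 4 ≤ 3 + deg y zs
      4≤ = s≤s (s≤s (s≤s (≤-trans (s≤s (z≤n {d})) (≤-reflexive (≡.sym dy)))))
  Robust⇒4r≤cost (suc k) xs@(c ∷ ys) l u (suc r) rob | inj₂ ds = le , tight
    where
    half : 2 * suc r ≤ length xs
    half = Robust⇒2r≤length rob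
    4* : ∀ r → 4 * r ≡ 2 * (2 * r)
    4* = solve-∀
    le : 4 * suc r ≤ cost xs
    le = ≤-trans (≤-reflexive (4* (suc r))) (≤-trans (*-monoʳ-≤ 2 half) (≤-reflexive (≡.sym (regular⇒cost ds))))
    tight : Tight (suc r) xs
    tight eq = even , length≡
      where
      length≡ : length xs ≡ 2 * suc r
      length≡ = *-cancelˡ-≡ _ _ 2 (≡.trans (≡.sym (regular⇒cost ds)) (≡.trans (≡.sym eq) (4* (suc r))))
      -- The cycle has cost 8 and accounts for two matching edges, so equality passes on to `ws`. If
      -- `s` = 0, the list has only two vertices, too few for a cycle.
      cycle : FourCycle c ys → ∀ {s} → s ≡ r → Even (suc s)
      cycle F {zero} refl =
        contradiction (≤-trans (≤-reflexive (≡.sym (↭-length (FourCycle.perm F)))) (≤-reflexive (suc-injective length≡))) (<⇒≱ (s≤s (s≤s z≤n)))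
      cycle F {suc s} refl = Even-suc² (proj₁ (proj₂ IH (+-cancelˡ-≡ 8 _ _ (≡.trans (8+ s) (≡.trans eq cost≡)))))
        where
        open FourCycle F
        8+ : ∀ s → 8 + 4 * s ≡ 4 * suc (suc s)
        8+ = solve-∀
        l′ : length ws ≤ k
        l′ = ≤-trans (m≤n+m (length ws) 3) (≤-trans (≤-reflexive (≡.sym (↭-length perm))) (≤-pred l))
        u′ : Unique ws
        u′ with _ ∷ _ ∷ _ ∷ v ← Unique-resp-↭ perm (Unique-tail u) = v
        IH = Robust⇒4r≤cost k ws l′ u′ s (fourCycle-rest F (Robust-delete rob))
      even : Even (suc r)
      even with regular-structure u ds
      ... | inj₁ far = contradiction (≤-trans (s≤s (≤-trans (≤-reflexive (*-suc 2 r)) (far (Robust-delete rob)))) (≤-reflexive length≡)) 1+n≰n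
      ... | inj₂ F = cycle F refl

  -- One vertex may be deleted along with the red matching: it is the far end of the red edge
  -- at the centre of the fan.
  VertexRobust : ℕ → List V → Set
  VertexRobust n xs = ∀ {v ys} → xs ↭ v ∷ ys → Robust n ys

  -- One deletion of cost at least 4 is followed by the bound 4n for the rest. Equality after
  -- deleting a vertex of degree at least 3 leaves 2n vertices; then all 2n + 1 degrees are at least
  -- 3, which is too many edges for even `n`. In the 2-regular case `c` itself is deleted, and
  -- tightness makes `n` - 1 even. The list has to be nonempty since `VertexRobust` says nothing
  -- about the empty one.
  VertexRobust⇒4n+4≤cost : ∀ k xs → length xs ≤ k → Unique xs → 1 ≤ length xs → ∀ {n} → 1 ≤ n →
    VertexRobust n xs → 4 * suc n ≤ cost xs × (Even n → 4 * suc n ≢ cost xs)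
  VertexRobust⇒4n+4≤cost zero xs l u 1≤l _ _ = contradiction (≤-trans 1≤l l) λ ()
  VertexRobust⇒4n+4≤cost (suc k) xs l u 1≤l {n} 1≤n rob with any-or-all (λ x → classify-degree (deg x xs)) xs
  ... | inj₁ (v , v∈ , inj₁ d≡0)
    with ys , p ← ∈⇒↭ v∈ = isolated ys p
    where
    without : ∀ {ys} → xs ↭ v ∷ ys → VertexRobust n ys
    without p {w} q = Robust-isolated
      (m+n≡0⇒n≡0 ⟦ adj G v w ⟧ (≡.trans (≡.sym (deg-↭ v q)) (≡.trans (≡.sym (deg-head p)) d≡0)))
      (rob (trans p (trans (prep v q) (swap v w refl))))
    isolated : ∀ ys → xs ↭ v ∷ ys → 4 * suc n ≤ cost xs × (Even n → 4 * suc n ≢ cost xs)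
    isolated [] p = contradiction (≤-trans (*-monoʳ-≤ 2 1≤n) (Robust⇒2r≤length (rob p))) λ ()
    isolated ys@(_ ∷ _) p
      with _ ∷ uys ← Unique-resp-↭ p u
      with le , _ ← VertexRobust⇒4n+4≤cost k ys (≤-pred (≤-trans (≤-reflexive (≡.sym (↭-length p))) l)) uys (s≤s z≤n) 1≤n
                      (without p) =
      <⇒≤ lt , λ _ → <⇒≢ lt
      where
      lt : 4 * suc n < cost xs
      lt = ≤-trans (s≤s (≤-trans le (m≤n+m (cost ys) (deg v ys)))) (≤-reflexive (≡.sym (≡.trans (cost-↭ p) (cost-∷ v ys))))
  ... | inj₁ (v , v∈ , inj₂ (inj₂ 3≤d))
    with ys , p ← ∈⇒↭ v∈
    with _ ∷ uys ← Unique-resp-↭ p u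
    with le , tight ← Robust⇒4r≤cost (length ys) ys ≤-refl uys n (rob p) =
    ≤-trans (4*suc≤ 4≤ le) (≤-reflexive (≡.sym c≡)) , λ even eq → impossible even eq (proj₂ (tight (proj₁ (4*suc≡ 4≤ le (≡.trans eq c≡)))))
    where
    c≡ : cost xs ≡ suc (deg v ys) + cost ys
    c≡ = ≡.trans (cost-↭ p) (cost-∷ v ys)
    4≤ : 4 ≤ suc (deg v ys)
    4≤ = s≤s (≤-trans 3≤d (≤-reflexive (deg-head p)))
    -- The inequality says 2n ≤ 3. It does hold for `n` = 1, and this is where parity enters.
    small : ∀ {n} → Even n → 1 ≤ n → 3 * suc (2 * n) ≤ 6 + 4 * n → ⊥
    small {zero} _ () _
    small {suc zero} e _ _ = Even-suc⇒¬Even e (0 , refl)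
    small {suc (suc n)} _ _ h = contradiction (≤-trans (≤-reflexive (eq n)) (≤-trans h (≤-reflexive (eq′ n)))) (m+n≰n _)
      where
      m+n≰n : ∀ m → ¬ (1 + 2 * n + m ≤ m)
      m+n≰n m le = m+1+n≰m m (≤-trans (≤-reflexive (+-comm m (suc (2 * n)))) le)
      eq : ∀ n → 1 + 2 * n + (14 + 4 * n) ≡ 3 * suc (2 * suc (suc n))
      eq = solve-∀
      eq′ : ∀ n → 6 + 4 * suc (suc n) ≡ 14 + 4 * n
      eq′ = solve-∀
    impossible : Even n → 4 * suc n ≡ cost xs → length ys ≡ 2 * n → ⊥
    impossible even eq lys = small even 1≤n (≤-trans (≤-reflexive (cong (3 *_) (≡.sym lxs)))
      (≤-trans (sumDeg-≥ {3} {xs} {xs} (All.tabulate min)) (≤-reflexive (≡.trans (handshake xs) 2E))))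
      where
      lxs : length xs ≡ suc (2 * n)
      lxs = ≡.trans (↭-length p) (cong suc lys)
      2E : 2 * E xs ≡ 6 + 4 * n
      2E = ≡.trans (cong (2 *_) (+-cancelˡ-≡ (suc (2 * n)) _ _
             (≡.trans (cong (_+ E xs) (≡.sym lxs)) (≡.trans (≡.sym eq) (split n))))) (dbl n)
        where
        split : ∀ n → 4 * suc n ≡ suc (2 * n) + (3 + 2 * n)
        split = solve-∀
        dbl : ∀ n → 2 * (3 + 2 * n) ≡ 6 + 4 * n
        dbl = solve-∀
      -- A vertex of degree at most 2 could be isolated by deleting one neighbour and
      -- colouring the edge to the other one red.
      lonely : ∀ {w x zs} → xs ↭ w ∷ x ∷ zs → deg x zs ≤ 1 → ⊥
      lonely {w} {x} {zs} q d with _ ∷ u′ ← Unique-resp-↭ q u =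
        contradiction (≤-trans (≤-reflexive (≡.trans (≡.sym (↭-length q)) lxs)) (s≤s (Robust-deg≤1⇒2r≤length u′ d (rob q)))) 1+n≰n
      no-small : ∀ {x} → x ∈ xs → ∀ d → deg x xs ≡ d → d ≤ 2 → ⊥
      no-small {x} x∈ zero dx _ with ∈-resp-↭ p x∈
      ... | here refl = contradiction (≤-trans 3≤d (≤-reflexive dx)) λ ()
      ... | there x∈ys with ws , q ← ∈⇒↭ x∈ys =
        lonely (trans p (prep v q)) (≤-trans (≤-reflexive (m+n≡0⇒n≡0 ⟦ adj G x v ⟧
          (≡.trans (cong (⟦ adj G x v ⟧ +_) (≡.sym (deg-head q))) (≡.trans (≡.sym (deg-↭ x p)) dx)))) z≤n)
      no-small {x} x∈ (suc d) dx (s≤s d≤1)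
        with zs , q ← ∈⇒↭ x∈
        with y , ws , q′ , x~y , d′ ← neighbour zs (≡.trans (≡.sym (deg-head q)) dx) =
        lonely (trans q (trans (prep x q′) (swap x y refl))) (≤-trans (≤-reflexive d′) d≤1)
      min : ∀ {x} → x ∈ xs → 3 ≤ deg x xs
      min x∈ = ≰⇒> (no-small x∈ _ refl)
  ... | inj₁ (x , x∈ , inj₂ (inj₁ d≡1))
    with ys , p ← ∈⇒↭ x∈
    with y , zs , p′ , x~y , dx ← neighbour ys (≡.trans (≡.sym (deg-head p)) d≡1)
    with u′@(_ ∷ _ ∷ uzs) ← Unique-resp-↭ (trans p (prep x p′)) u = leaf
    where
    q : xs ↭ x ∷ y ∷ zs
    q = trans p (prep x p′)
    l′ : length zs ≤ k
    l′ = ≤-trans (n≤1+n _) (≤-pred (≤-trans (≤-reflexive (≡.sym (↭-length q))) l))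
    c≡ : cost xs ≡ 3 + deg y zs + cost zs
    c≡ = ≡.trans (cost-↭ q) (≡.trans (cost-∷∷ x y zs)
      (cong (λ d → suc d + suc (deg y zs) + cost zs) (≡.trans (deg-~ zs x~y) (cong suc dx))))
    leaf : 4 * suc n ≤ cost xs × (Even n → 4 * suc n ≢ cost xs)
    leaf with deg y zs in dy
    ... | zero = edge zs dx dy q u′ uzs l′ (≡.trans c≡ (cong (λ d → 3 + d + cost zs) dy))
      where
      without : ∀ {zs} → deg x zs ≡ 0 → deg y zs ≡ 0 → xs ↭ x ∷ y ∷ zs → Unique (x ∷ y ∷ zs) → VertexRobust n zs
      without {zs} dx dy q u′ {w} {ws} r =
        Robust-pair (Unique-tail (Unique-resp-↭ s u′)) (smaller x dx) (smaller y dy) (rob (trans q s))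
        where
        s : x ∷ y ∷ zs ↭ w ∷ x ∷ y ∷ ws
        s = trans (prep x (trans (prep y r) (swap y w refl))) (swap x w refl)
        smaller : ∀ t → deg t zs ≡ 0 → deg t ws ≡ 0
        smaller t e = m+n≡0⇒n≡0 ⟦ adj G t w ⟧ (≡.trans (≡.sym (deg-↭ t r)) e)
      edge : ∀ zs → deg x zs ≡ 0 → deg y zs ≡ 0 → xs ↭ x ∷ y ∷ zs → Unique (x ∷ y ∷ zs) → Unique zs → length zs ≤ k →
        cost xs ≡ 3 + cost zs → 4 * suc n ≤ cost xs × (Even n → 4 * suc n ≢ cost xs)
      edge [] _ _ q _ _ _ _ = contradiction (≤-trans (*-monoʳ-≤ 2 1≤n) (Robust⇒2r≤length (rob q))) λ { (s≤s ()) }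
      edge zs@(_ ∷ _) dx dy q u′ uzs l′ c≡
        with le , _ ← VertexRobust⇒4n+4≤cost k zs l′ uzs (s≤s z≤n) 1≤n (without dx dy q u′) =
        <⇒≤ lt , λ _ → <⇒≢ lt
        where
        lt : 4 * suc n < cost xs
        lt = ≤-trans (s≤s (≤-trans le (m≤n+m (cost zs) 2))) (≤-reflexive (≡.sym c≡))
    ... | suc d
      with le , tight ← Robust⇒4r≤cost k zs l′ uzs n (Robust-isolated dx (rob (trans q (swap x y refl)))) =
      ≤-trans (4*suc≤ 4≤ le) (≤-reflexive (≡.sym c≡)) , λ _ eq → impossible (4*suc≡ 4≤ le (≡.trans eq c≡))
      where
      4≤ : 4 ≤ 3 + deg y zs
      4≤ = s≤s (s≤s (s≤s (≤-trans (s≤s (z≤n {d})) (≤-reflexive (≡.sym dy)))))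
      -- Deleting the other neighbour z of y and colouring xy red isolates both x and y.
      impossible : 4 * n ≡ cost zs × 3 + deg y zs ≡ 4 → ⊥
      impossible (eq , d≡) with z , ws , r , y~z , dy′ ← neighbour zs (+-cancelˡ-≡ 3 _ _ d≡) =
        contradiction
          (≤-trans (≤-reflexive (≡.trans (≡.sym (↭-length r)) (proj₂ (tight eq))))
            (Robust⇒2r≤length (Robust-pair (Unique-tail (Unique-resp-↭ s u′))
              (m+n≡0⇒n≡0 ⟦ adj G x z ⟧ (≡.trans (≡.sym (deg-↭ x r)) dx)) dy′ (rob (trans q s)))))
          1+n≰n
        where
        s : x ∷ y ∷ zs ↭ z ∷ x ∷ y ∷ ws
        s = trans (prep x (trans (prep y r) (swap y z refl))) (swap x z refl)
  VertexRobust⇒4n+4≤cost (suc k) (c ∷ ys) l u 1≤l {suc n} 1≤n rob | inj₂ ds with regular-structure u ds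
  -- Deleting `c` and isolating two of its former neighbours gives at least 2n + 3 vertices for the
  -- given fan size n, and a 2-regular graph costs twice that.
  ... | inj₁ far = <⇒≤ lt , λ _ → <⇒≢ lt
    where
    lt : 4 * suc (suc n) < cost (c ∷ ys)
    lt = ≤-trans (≤-trans (n≤1+n _) (≤-reflexive (eq (suc n)))) (≤-trans (*-monoʳ-≤ 2 (s≤s (far (rob refl)))) (≤-reflexive (≡.sym (regular⇒cost ds))))
      where
      eq : ∀ n → 2 + 4 * suc n ≡ 2 * (3 + 2 * n)
      eq = solve-∀
  ... | inj₂ F = ≤-trans (≤-reflexive (8+ n)) (≤-trans (+-monoʳ-≤ 8 (proj₁ bound)) (≤-reflexive (≡.sym cost≡))) ,
    λ even eq → Even-suc⇒¬Even even (proj₁ (proj₂ bound (+-cancelˡ-≡ 8 _ _ (≡.trans (≡.sym (8+ n)) (≡.trans eq cost≡)))))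
    where
    open FourCycle F
    8+ : ∀ n → 4 * suc (suc n) ≡ 8 + 4 * n
    8+ = solve-∀
    u′ : Unique ws
    u′ with _ ∷ _ ∷ _ ∷ v ← Unique-resp-↭ perm (Unique-tail u) = v
    bound : 4 * n ≤ cost ws × Tight n ws
    bound = Robust⇒4r≤cost (length ws) ws ≤-refl u′ n (fourCycle-rest F (rob refl))

-- Fans as matchings

verts-tabulate : ∀ {n} {P : A → Set} (a b : Fin n → A) → (∀ i → P (a i)) → (∀ i → P (b i)) →
  All P (verts (tabulate λ i → a i , b i))
verts-tabulate {n = zero} a b pa pb = []
verts-tabulate {n = suc n} a b pa pb =
  pa Fin.zero ∷ pb Fin.zero ∷ verts-tabulate (a ∘ Fin.suc) (b ∘ Fin.suc) (pa ∘ Fin.suc) (pb ∘ Fin.suc)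

Unique-verts-tabulate : ∀ {n} (a b : Fin n → A) → Injective _≡_ _≡_ a → Injective _≡_ _≡_ b → (∀ i j → a i ≢ b j) →
  Unique (verts (tabulate λ i → a i , b i))
Unique-verts-tabulate {n = zero} a b ia ib a≢b = []
Unique-verts-tabulate {n = suc n} a b ia ib a≢b =
  (a≢b Fin.zero Fin.zero ∷ verts-tabulate _ _ (λ i eq → case ia eq of λ ()) (λ i → a≢b Fin.zero (Fin.suc i))) ∷
  verts-tabulate _ _ (λ i eq → a≢b (Fin.suc i) Fin.zero (≡.sym eq)) (λ i eq → case ib eq of λ ()) ∷
  Unique-verts-tabulate _ _ (Fin.suc-injective ∘ ia) (Fin.suc-injective ∘ ib) (λ i j → a≢b (Fin.suc i) (Fin.suc j))

isOdd-1+2* : ∀ k → isOdd (suc (2 * k)) ≡ true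
isOdd-1+2* zero = refl
isOdd-1+2* (suc k) rewrite +-suc k (k + 0) | isOdd-1+2* k = refl

≡ᵇ-refl : ∀ n → (n ≡ᵇ n) ≡ true
≡ᵇ-refl zero = refl
≡ᵇ-refl (suc n) = ≡ᵇ-refl n

fanAdj-pair : ∀ k → fanAdj (suc (2 * k)) (suc (suc (2 * k))) ≡ true
fanAdj-pair k rewrite isOdd-1+2* k | ≡ᵇ-refl (2 * k) = refl

module FanPositions (n : ℕ) where

  left< : ∀ (k : Fin n) → suc (2 * toℕ k) < suc (2 * n)
  left< k = s≤s (*-monoʳ-< 2 (Fin.toℕ<n k))

  right< : ∀ (k : Fin n) → suc (suc (2 * toℕ k)) < suc (2 * n)
  right< k = s≤s (≤-trans (≤-reflexive (≡.sym (*-suc 2 (toℕ k)))) (*-monoʳ-≤ 2 (Fin.toℕ<n k)))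

  left right : Fin n → Fin (suc (2 * n))
  left k = Fin.fromℕ< (left< k)
  right k = Fin.fromℕ< (right< k)

  toℕ-left : ∀ k → toℕ (left k) ≡ suc (2 * toℕ k)
  toℕ-left k = Fin.toℕ-fromℕ< (left< k)

  toℕ-right : ∀ k → toℕ (right k) ≡ suc (suc (2 * toℕ k))
  toℕ-right k = Fin.toℕ-fromℕ< (right< k)

  left-injective : Injective _≡_ _≡_ left
  left-injective {i} {j} eq = Fin.toℕ-injective (*-cancelˡ-≡ _ _ 2 (suc-injective
    (≡.trans (≡.sym (toℕ-left i)) (≡.trans (cong toℕ eq) (toℕ-left j)))))

  right-injective : Injective _≡_ _≡_ right
  right-injective {i} {j} eq = Fin.toℕ-injective (*-cancelˡ-≡ _ _ 2 (suc-injective (suc-injective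
    (≡.trans (≡.sym (toℕ-right i)) (≡.trans (cong toℕ eq) (toℕ-right j))))))

  left≢right : ∀ i j → left i ≢ right j
  left≢right i j eq with e ← ≡.trans (≡.sym (toℕ-left i)) (≡.trans (cong toℕ eq) (toℕ-right j)) =
    Even-suc⇒¬Even (toℕ i , ≡.sym (suc-injective e)) (toℕ j , refl)

  centre-left : ∀ k → adj (Fan n) Fin.zero (left k) ≡ true
  centre-left k = refl

  centre-right : ∀ k → adj (Fan n) Fin.zero (right k) ≡ true
  centre-right k = refl

  left-right : ∀ k → adj (Fan n) (left k) (right k) ≡ true
  left-right k = ≡.trans (cong₂ fanAdj (toℕ-left k) (toℕ-right k)) (fanAdj-pair (toℕ k))

-- From arrowing to fans under a red matching

module FanExtraction {N : ℕ} (G : Graph N) where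
  open Colourings G
  open Bounds G

  all : List V
  all = allFin N

  record Triangle (f : V → V) (a b c : V) : Set where
    constructor mkTriangle
    field
      ab : a ~ b
      ac : a ~ c
      bc : b ~ c
      ¬ab : f a ≢ b
      ¬ac : f a ≢ c
      ¬bc : f b ≢ c

  extend : ∀ {xs} → Involution xs → Involution all
  extend = weaken (λ _ → ∈-allFin _)

  -- A fixed point makes only a diagonal entry red, and a pair that is not an edge has an irrelevant
  -- colour; neither affects `G`.
  colouring : Involution all → Colouring N
  colouring m = (λ i j → ⌊ ι m i Fin.≟ j ⌋) , symmetric
    where
    symmetric : ∀ i j → ⌊ ι m i Fin.≟ j ⌋ ≡ ⌊ ι m j Fin.≟ i ⌋
    symmetric i j with ι m i Fin.≟ j | ι m j Fin.≟ i
    ... | yes _ | yes _ = refl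
    ... | no _ | no _ = refl
    ... | yes e | no ¬e = contradiction (≡.trans (cong (ι m) (≡.sym e)) (involutive m i)) ¬e
    ... | no ¬e | yes e = contradiction (≡.trans (cong (ι m) (≡.sym e)) (involutive m j)) ¬e

  does-true : ∀ {i j : V} → ⌊ i Fin.≟ j ⌋ ≡ true → i ≡ j
  does-true {i} {j} eq with i Fin.≟ j
  ... | yes e = e

  does-false : ∀ {i j : V} → ⌊ i Fin.≟ j ⌋ ≡ false → i ≢ j
  does-false {i} {j} eq with i Fin.≟ j
  ... | no ¬e = ¬e

  -- Both ends of a red `P₃` would be the partner of its middle vertex under `ι m`, so the arrowing
  -- must produce a blue fan. It is returned as its centre and the list of its rim edges.
  arrows⇒fan : ∀ {n} → Arrows G P₃ (Fan n) → ∀ {xs} (m : Involution xs) →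
    ∃₂ λ c L → IsMatching (Triangle (ι m) c) L × length L ≡ n
  arrows⇒fan {n} arr m with arr (colouring (extend m))
  ... | inj₁ (f , inj , e)
    with _ , r₀ ← e (Fin.suc Fin.zero) Fin.zero refl
    with _ , r₂ ← e (Fin.suc Fin.zero) (Fin.suc (Fin.suc Fin.zero)) refl =
    case inj (≡.trans (≡.sym (does-true r₀)) (does-true r₂)) of λ ()
  ... | inj₂ (f , inj , e) =
    f Fin.zero , tabulate (λ k → f (left k) , f (right k)) ,
    (Unique-verts-tabulate (f ∘ left) (f ∘ right) (left-injective ∘ inj) (right-injective ∘ inj) (λ i j → left≢right i j ∘ inj) ,
     All.tabulate⁺ triangle) ,
    length-tabulate (λ k → f (left k) , f (right k))
    where
    open FanPositions n
    triangle : ∀ k → Triangle (ι m) (f Fin.zero) (f (left k)) (f (right k))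
    triangle k
      with ca , ¬ca ← e Fin.zero (left k) (centre-left k)
      with cb , ¬cb ← e Fin.zero (right k) (centre-right k)
      with ab , ¬ab ← e (left k) (right k) (left-right k) =
      mkTriangle ca cb ab (does-false ¬ca) (does-false ¬cb) (does-false ¬ab)

  nbrs : V → List V → List V
  nbrs c = filter (λ y → adj G c y Bool.≟ true)

  length-nbrs : ∀ c xs → length (nbrs c xs) ≡ deg c xs
  length-nbrs c [] = refl
  length-nbrs c (x ∷ xs) with adj G c x Bool.≟ true
  ... | yes e rewrite e = cong suc (length-nbrs c xs)
  ... | no ¬e rewrite ≢true⇒≡false ¬e = length-nbrs c xs

  deg-nbrs : ∀ v c xs → deg v (nbrs c xs) ≤ deg v xs
  deg-nbrs v c [] = z≤n
  deg-nbrs v c (x ∷ xs) with adj G c x Bool.≟ true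
  ... | yes _ = +-monoʳ-≤ ⟦ adj G v x ⟧ (deg-nbrs v c xs)
  ... | no _ = ≤-trans (deg-nbrs v c xs) (m≤n+m _ _)

  E-nbrs : ∀ c xs → E (nbrs c xs) ≤ E xs
  E-nbrs c [] = z≤n
  E-nbrs c (x ∷ xs) with adj G c x Bool.≟ true
  ... | yes _ = +-mono-≤ (deg-nbrs x c xs) (E-nbrs c xs)
  ... | no _ = ≤-trans (E-nbrs c xs) (m≤n+m _ _)

  cost-nbrs : ∀ c xs → cost (nbrs c xs) ≤ deg c xs + E xs
  cost-nbrs c xs = +-mono-≤ (≤-reflexive (length-nbrs c xs)) (E-nbrs c xs)

  -- The rim vertices are distinct neighbours of the centre. The list `ys` allows the far end of a
  -- red spoke to be left out of the count.
  fan-degree : ∀ {f c L ys} → IsMatching (Triangle f c) L → (∀ {a} → c ~ a → f c ≢ a → a ∈ ys) → 2 * length L ≤ deg c ys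
  fan-degree {c = c} {ys = ys} M inside = ≤-trans
    (matching-bound (λ { (mkTriangle ca cb _ ¬ca ¬cb _) → mem ca ¬ca , mem cb ¬cb }) M)
    (≤-reflexive (length-nbrs c ys))
    where
    mem : ∀ {a} → c ~ a → _ → a ∈ nbrs c ys
    mem ca ¬ca = ∈-filter⁺ _ (inside ca ¬ca) ca

  E-all : ∀ {xs} → all ↭ xs → edgeCount G ≡ E xs
  E-all p = ≡.trans (edgeCount≡edgesIn G) (E-↭ p)

  -- The deleted vertex v is accounted for by colouring the spoke cv red.
  centre⇒VertexRobust : ∀ {n c rest} → all ↭ c ∷ rest →
    (∀ (m : Involution all) → ∃[ L ] IsMatching (Triangle (ι m) c) L × length L ≡ n) → VertexRobust n (nbrs c rest)
  centre⇒VertexRobust {n} {c} {rest} p fan {v} {ys} q m = restrict (fan (extend (pair c v u m)))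
    where
    u₀ : Unique (c ∷ rest)
    u₀ = Unique-resp-↭ p (Unique.allFin⁺ N)
    u₁ : Unique (v ∷ ys)
    u₁ = Unique-resp-↭ q (Unique.filter⁺ _ (Unique-tail u₀))
    nbr : ∀ {a} → a ∈ v ∷ ys → c ~ a
    nbr a∈ = proj₂ (∈-filter⁻ (λ y → adj G c y Bool.≟ true) {xs = rest} (∈-resp-↭ (↭-sym q) a∈))
    u : Unique (c ∷ v ∷ ys)
    u = All.tabulate (λ a∈ → ~⇒≢ (nbr a∈)) ∷ u₁
    mem : ∀ {a} → c ~ a → ι (pair c v u m) c ≢ a → a ∈ ys
    mem c~a ¬ca = ∈-tail
      (∈-resp-↭ q (∈-filter⁺ _ (∈-tail (∈-resp-↭ p (∈-allFin _)) (~⇒≢ c~a ∘ ≡.sym)) c~a))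
      (λ { refl → ¬ca (pair-x c v u m) })
    blue : ∀ {a b} → Triangle (ι (pair c v u m)) c a b → Blue (ι m) ys a b
    blue (mkTriangle ca cb ab ¬ca ¬cb ¬ab) = mkBlue (mem ca ¬ca) (mem cb ¬cb) ab
      λ e → ¬ab (≡.trans (pair-z c v u m (~⇒≢ ca ∘ ≡.sym) (λ { refl → ¬ca (pair-x c v u m) })) e)
    restrict : ∃[ L ] IsMatching (Triangle (ι (pair c v u m)) c) L × length L ≡ n →
      ∃[ L ] IsMatching (Blue (ι m) ys) L × n ≤ length L
    restrict (L , M , l) = L , mapMatching blue M , ≤-reflexive (≡.sym l)

-- Counting edges at the vertices of large degree

all-true : ∀ {a b c} → 3 ≤ ⟦ a ⟧ + ⟦ b ⟧ + ⟦ c ⟧ → a ≡ true × b ≡ true × c ≡ true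
all-true {true} {true} {true} _ = refl , refl , refl
all-true {true} {true} {false} (s≤s (s≤s ()))
all-true {true} {false} {true} (s≤s (s≤s ()))
all-true {true} {false} {false} (s≤s ())
all-true {false} {true} {true} (s≤s (s≤s ()))
all-true {false} {true} {false} (s≤s ())
all-true {false} {false} {true} (s≤s ())

sandwich : ∀ {n x y z e} → n ≤ x → n ≤ y → n ≤ z → x + y + z + e ≤ n + n + n → x ≤ n × y ≤ n × z ≤ n × e ≡ 0
sandwich {n} {x} {y} {z} {e} nx ny nz h =
  bound x (eq₁ x y z e) (+-mono-≤ ny nz) , bound y (eq₂ x y z e) (+-mono-≤ nx nz) , bound z (eq₃ x y z e) (+-mono-≤ nx ny) ,
  n≤0⇒n≡0 (+-cancelˡ-≤ (n + n + n) e 0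
    (≤-trans (+-monoˡ-≤ e (+-mono-≤ (+-mono-≤ nx ny) nz)) (≤-trans h (≤-reflexive (≡.sym (+-identityʳ _))))))
  where
  bound : ∀ w {r} → x + y + z + e ≡ w + r + e → n + n ≤ r → w ≤ n
  bound w {r} eq nr = +-cancelʳ-≤ (n + n) w n
    (≤-trans (+-monoʳ-≤ w nr) (≤-trans (m≤m+n (w + r) e) (≤-trans (≤-reflexive (≡.sym eq)) (≤-trans h (≤-reflexive (+-assoc n n n))))))
  eq₁ : ∀ x y z e → x + y + z + e ≡ x + (y + z) + e
  eq₁ = solve-∀
  eq₂ : ∀ x y z e → x + y + z + e ≡ y + (x + z) + e
  eq₂ = solve-∀
  eq₃ : ∀ x y z e → x + y + z + e ≡ z + (x + y) + e
  eq₃ = solve-∀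

module LargeFans {N : ℕ} (G : Graph N) where
  open Colourings G
  open Bounds G
  open FanExtraction G

  open DecMembership (Fin._≟_ {N}) using (_∈?_)

  Big : ℕ → V → Set
  Big n c = 2 * n ≤ deg c all

  fan⇒Big : ∀ {n f c L} → IsMatching (Triangle f c) L → length L ≡ n → Big n c
  fan⇒Big {c = c} M refl = fan-degree M (λ _ _ → ∈-allFin _)

  other-big : ∀ n cs → (∃[ c ] c ∉ cs × Big n c) ⊎ (∀ {c} → Big n c → c ∈ cs)
  other-big n cs with any-or-all decide all
    where
    decide : ∀ c → (c ∉ cs × Big n c) ⊎ (Big n c → c ∈ cs)
    decide c with c ∈? cs | 2 * n ≤? deg c all
    ... | yes c∈ | _ = inj₂ λ _ → c∈
    ... | no c∉ | yes big = inj₁ (c∉ , big)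
    ... | no _ | no ¬big = inj₂ λ big → contradiction big ¬big
  ... | inj₁ (c , _ , h) = inj₁ (c , h)
  ... | inj₂ hs = inj₂ λ {c} big → All.lookup hs (∈-allFin c) big

  -- Every blue fan sits at `c`, so the neighbourhood of `c` is `VertexRobust`; its cost counts
  -- distinct edges of `G`.
  one-centre : ∀ {n c} → 1 ≤ n → Arrows G P₃ (Fan n) → Big n c → (∀ {c′} → Big n c′ → c′ ∈ c ∷ []) →
    4 * suc n ≤ edgeCount G × (Even n → 4 * suc n ≢ edgeCount G)
  one-centre {n} {c} 1≤n arr big only with rest , p ← ∈⇒↭ (∈-allFin c) =
    ≤-trans (proj₁ bound) cost≤ , λ even eq → proj₂ bound even (≤-antisym (proj₁ bound) (≤-trans cost≤ (≤-reflexive (≡.sym eq))))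
    where
    xs = nbrs c rest
    fan : (m : Involution all) → ∃[ L ] IsMatching (Triangle (ι m) c) L × length L ≡ n
    fan m with c′ , L , M , l ← arrows⇒fan arr m with only (fan⇒Big M l)
    ... | here refl = L , M , l
    1≤length : 1 ≤ length xs
    1≤length = ≤-trans 1≤n (≤-trans (m≤m+n n (n + 0)) (≤-trans big (≤-reflexive (≡.trans (deg-head p) (≡.sym (length-nbrs c rest))))))
    bound = VertexRobust⇒4n+4≤cost (length xs) xs ≤-refl
      (Unique.filter⁺ _ (Unique-tail (Unique-resp-↭ p (Unique.allFin⁺ N)))) 1≤length 1≤n (centre⇒VertexRobust p fan)
    cost≤ : cost xs ≤ edgeCount G
    cost≤ = ≤-trans (cost-nbrs c rest) (≤-reflexive (≡.sym (E-all p)))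

  -- With `cd` red, a fan centred at one of the two vertices avoids the other, so its rim lies in
  -- `rest`. Hence `rest` is robust and holds 2n edges besides those at `c` and `d`.
  two-centres : ∀ {n c d} → c ≢ d → Arrows G P₃ (Fan n) → Big n c → Big n d → (∀ {c′} → Big n c′ → c′ ∈ c ∷ d ∷ []) →
    6 * n ≤ 2 + edgeCount G
  two-centres {n} {c} {d} c≢d arr bigc bigd only
    with rest₁ , p₁ ← ∈⇒↭ (∈-allFin c)
    with rest , p₂ ← ∈⇒↭ (∈-tail (∈-resp-↭ p₁ (∈-allFin d)) (c≢d ∘ ≡.sym)) =
    begin
      6 * n ≡⟨ eq n ⟩
      2 * n + 2 * n + 2 * n ≤⟨ +-mono-≤ (+-mono-≤ degc degd) (Robust⇒2r≤E (length rest) rest ≤-refl (Unique-tail (Unique-tail u)) robust) ⟩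
      a + deg c rest + (a + deg d rest) + E rest ≡⟨ eq′ a (deg c rest) (deg d rest) (E rest) ⟩
      -- Only the edge `cd` is counted twice; the constant is relaxed from 1 to 2 to match the case
      -- of three centres.
      a + E (c ∷ d ∷ rest) ≤⟨ +-monoˡ-≤ _ (≤-trans (⟦⟧≤1 (adj G c d)) (n≤1+n 1)) ⟩
      2 + E (c ∷ d ∷ rest) ≡⟨ cong (2 +_) (E-all p) ⟨
      2 + edgeCount G ∎
    where
    open ≤-Reasoning
    a = ⟦ adj G c d ⟧
    eq : ∀ n → 6 * n ≡ 2 * n + 2 * n + 2 * n
    eq = solve-∀
    eq′ : ∀ a b c d → a + b + (a + c) + d ≡ a + (a + b + (c + d))
    eq′ = solve-∀
    p : all ↭ c ∷ d ∷ rest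
    p = trans p₁ (prep c p₂)
    u : Unique (c ∷ d ∷ rest)
    u = Unique-resp-↭ p (Unique.allFin⁺ N)
    degc : 2 * n ≤ a + deg c rest
    degc = ≤-trans bigc (≤-reflexive (deg-head p))
    degd : 2 * n ≤ a + deg d rest
    degd = ≤-trans bigd (≤-reflexive (≡.trans (deg-head (trans p (swap c d refl))) (cong (λ b → ⟦ b ⟧ + deg d rest) (sym G d c))))
    robust : Robust n rest
    robust m = restrict (arrows⇒fan arr cd)
      where
      cd = pair c d u m
      blue : ∀ {c′} → Big n c′ → ∀ {a b} → Triangle (ι cd) c′ a b → Blue (ι m) rest a b
      blue {c′} big {a} {b} (mkTriangle ca cb ab ¬ca ¬cb ¬ab) =
        mkBlue (∈-tail (∈-tail (∈-resp-↭ p (∈-allFin a)) (proj₁ (apart ca ¬ca))) (proj₂ (apart ca ¬ca)))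
               (∈-tail (∈-tail (∈-resp-↭ p (∈-allFin b)) (proj₁ (apart cb ¬cb))) (proj₂ (apart cb ¬cb)))
               ab λ e → ¬ab (≡.trans (uncurry (pair-z c d u m) (apart ca ¬ca)) e)
        where
        apart : ∀ {a} → c′ ~ a → ι cd c′ ≢ a → a ≢ c × a ≢ d
        apart ca ¬ca with only big
        ... | here refl = ~⇒≢ ca ∘ ≡.sym , λ { refl → ¬ca (pair-x c d u m) }
        ... | there (here refl) = (λ { refl → ¬ca (pair-y c d u m) }) , ~⇒≢ ca ∘ ≡.sym
      restrict : (∃₂ λ c′ L → IsMatching (Triangle (ι cd) c′) L × length L ≡ n) → ∃[ L ] IsMatching (Blue (ι m) rest) L × n ≤ length L
      restrict (c′ , L , M , l) = L , mapMatching (blue (fan⇒Big M l)) M , ≤-reflexive (≡.sym l)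

  -- Adding the three degrees counts at most three edges twice, so at least 6n - 3 edges exist. If
  -- there were no more, the three vertices would form a triangle, have degree exactly 2n and meet
  -- every edge, and a red matching of two edges would then destroy every fan.
  three-centres : ∀ {n c₁ c₂ c₃} → 2 ≤ n → Arrows G P₃ (Fan n) → c₁ ≢ c₂ → c₃ ≢ c₁ → c₃ ≢ c₂ →
    Big n c₁ → Big n c₂ → Big n c₃ → 6 * n ≤ 2 + edgeCount G
  three-centres {n} {c₁} {c₂} {c₃} 2≤n arr c₁≢c₂ c₃≢c₁ c₃≢c₂ big₁ big₂ big₃ with 6 * n ≤? 2 + edgeCount G
  ... | yes h = h
  ... | no ¬h
    with rest₁ , p₁ ← ∈⇒↭ (∈-allFin c₁)
    with rest₂ , p₂ ← ∈⇒↭ (∈-tail (∈-resp-↭ p₁ (∈-allFin c₂)) (c₁≢c₂ ∘ ≡.sym))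
    with rest , p₃ ← ∈⇒↭ (∈-tail (∈-tail (∈-resp-↭ (trans p₁ (prep c₁ p₂)) (∈-allFin c₃)) c₃≢c₁) c₃≢c₂) =
    ⊥-elim impossible
    where
    p : all ↭ c₁ ∷ c₂ ∷ c₃ ∷ rest
    p = trans p₁ (prep c₁ (trans p₂ (prep c₂ p₃)))
    a = ⟦ adj G c₁ c₂ ⟧
    b = ⟦ adj G c₁ c₃ ⟧
    g = ⟦ adj G c₂ c₃ ⟧
    e = E rest
    r₁ = deg c₁ rest
    r₂ = deg c₂ rest
    r₃ = deg c₃ rest
    h₁ : 2 * n ≤ a + (b + r₁)
    h₁ = ≤-trans big₁ (≤-reflexive (deg-head p))
    h₂ : 2 * n ≤ a + (g + r₂)
    h₂ = ≤-trans big₂ (≤-reflexive (≡.trans (deg-head (trans p (swap c₁ c₂ refl))) (cong (λ t → ⟦ t ⟧ + (g + r₂)) (sym G c₂ c₁))))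
    h₃ : 2 * n ≤ b + (g + r₃)
    h₃ = ≤-trans big₃ (≤-reflexive (≡.trans (deg-head (trans p (trans (prep c₁ (swap c₂ c₃ refl)) (swap c₁ c₃ refl))))
      (cong₂ (λ s t → ⟦ s ⟧ + (⟦ t ⟧ + r₃)) (sym G c₃ c₁) (sym G c₃ c₂))))
    total : a + (b + r₁) + (a + (g + r₂)) + (b + (g + r₃)) + e ≡ a + b + g + edgeCount G
    total = ≡.trans (eq a b g r₁ r₂ r₃ e) (cong (a + b + g +_) (≡.sym (E-all p)))
      where
      eq : ∀ a b g r₁ r₂ r₃ e → a + (b + r₁) + (a + (g + r₂)) + (b + (g + r₃)) + e
        ≡ a + b + g + (a + (b + r₁) + (g + r₂ + (r₃ + e)))
      eq = solve-∀
    6n : 6 * n ≡ 2 * n + 2 * n + 2 * n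
    6n = eq n
      where
      eq : ∀ n → 6 * n ≡ 2 * n + 2 * n + 2 * n
      eq = solve-∀
    complete : adj G c₁ c₂ ≡ true × adj G c₁ c₃ ≡ true × adj G c₂ c₃ ≡ true
    complete = all-true (+-cancelʳ-≤ (edgeCount G) 3 (a + b + g)
      (≤-trans (≰⇒> ¬h) (≤-trans (≤-reflexive 6n) (≤-trans (+-mono-≤ (+-mono-≤ h₁ h₂) h₃) (≤-trans (m≤m+n _ e) (≤-reflexive total))))))
    a≡1 = cong ⟦_⟧ (proj₁ complete)
    b≡1 = cong ⟦_⟧ (proj₁ (proj₂ complete))
    g≡1 = cong ⟦_⟧ (proj₂ (proj₂ complete))
    exact : a + (b + r₁) ≤ 2 * n × a + (g + r₂) ≤ 2 * n × b + (g + r₃) ≤ 2 * n × e ≡ 0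
    exact = sandwich h₁ h₂ h₃ (≤-trans (≤-reflexive total)
      (≤-trans (≤-reflexive (cong (_+ edgeCount G) (cong₂ _+_ (cong₂ _+_ a≡1 b≡1) g≡1))) (≤-trans (≰⇒> ¬h) (≤-reflexive 6n))))
    r₁+2 : 2 + r₁ ≤ 2 * n
    r₁+2 = ≤-trans (≤-reflexive (cong₂ (λ s t → s + (t + r₁)) (≡.sym a≡1) (≡.sym b≡1))) (proj₁ exact)
    r₂+2 : 2 + r₂ ≤ 2 * n
    r₂+2 = ≤-trans (≤-reflexive (cong₂ (λ s t → s + (t + r₂)) (≡.sym a≡1) (≡.sym g≡1))) (proj₁ (proj₂ exact))
    r₃+2 : 2 + r₃ ≡ 2 * n
    r₃+2 = ≤-antisym
      (≤-trans (≤-reflexive (cong₂ (λ s t → s + (t + r₃)) (≡.sym b≡1) (≡.sym g≡1))) (proj₁ (proj₂ (proj₂ exact))))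
      (≤-trans h₃ (≤-reflexive (cong₂ (λ s t → s + (t + r₃)) b≡1 g≡1)))
    positive : ∀ {r} → 2 + r ≡ 2 * n → ∃[ s ] r ≡ suc s
    positive {zero} eq = contradiction (≤-trans (*-monoʳ-≤ 2 2≤n) (≤-reflexive (≡.sym eq))) λ { (s≤s (s≤s ())) }
    positive {suc s} _ = s , refl
    -- All three vertices have degree exactly 2n, and the red edges c₁c₂ and c₃z cover them.
    impossible : ⊥
    impossible
      with s , r₃≡ ← positive r₃+2
      with z , us , q , c₃~z , d₃ ← neighbour rest r₃≡ = no-fan (arrows⇒fan arr m)
      where
      p′ : all ↭ c₁ ∷ c₂ ∷ c₃ ∷ z ∷ us
      p′ = trans p (prep c₁ (prep c₂ (prep c₃ q)))
      u : Unique (c₁ ∷ c₂ ∷ c₃ ∷ z ∷ us)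
      u = Unique-resp-↭ p′ (Unique.allFin⁺ N)
      m₀ = pair c₃ z (Unique-tail (Unique-tail u)) identity
      m = pair c₁ c₂ u m₀
      no-fan : (∃₂ λ c L → IsMatching (Triangle (ι m) c) L × length L ≡ n) → ⊥
      no-fan (c , L , M , refl) with ∈-resp-↭ p (∈-allFin c)
      ... | here refl = contradiction
        (≤-trans r₁+2 (≤-trans (fan-degree M (λ ca ¬ca → ∈-tail (∈-tail (∈-resp-↭ p (∈-allFin _)) (~⇒≢ ca ∘ ≡.sym))
          (λ { refl → ¬ca (pair-x c₁ c₂ u m₀) }))) (≤-reflexive (cong (_+ r₁) b≡1)))) 1+n≰n
      ... | there (here refl) = contradiction
        (≤-trans r₂+2 (≤-trans (fan-degree M (λ ca ¬ca → ∈-tail (∈-tail (∈-resp-↭ p (∈-allFin _))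
          (λ { refl → ¬ca (pair-y c₁ c₂ u m₀) })) (~⇒≢ ca ∘ ≡.sym))) (≤-reflexive (cong (_+ r₂) g≡1)))) 1+n≰n
      ... | there (there (here refl)) = contradiction
        (≤-trans (≤-reflexive (≡.trans (cong (2 +_) (≡.sym r₃≡)) r₃+2))
          (≤-trans (fan-degree {ys = c₁ ∷ c₂ ∷ us} M inside)
            (+-mono-≤ (⟦⟧≤1 (adj G c₃ c₁)) (+-mono-≤ (⟦⟧≤1 (adj G c₃ c₂)) (≤-reflexive d₃))))) 1+n≰n
        where
        inside : ∀ {a} → c₃ ~ a → ι m c₃ ≢ a → a ∈ c₁ ∷ c₂ ∷ us
        inside {a} ca ¬ca with ∈-resp-↭ p′ (∈-allFin a)
        ... | here refl = here refl
        ... | there (here refl) = there (here refl)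
        ... | there (there (here refl)) = contradiction refl (~⇒≢ ca)
        ... | there (there (there (here refl))) =
          contradiction (≡.trans (pair-z c₁ c₂ u m₀ c₃≢c₁ c₃≢c₂) (pair-x c₃ z (Unique-tail (Unique-tail u)) identity)) ¬ca
        ... | there (there (there (there a∈))) = there (there a∈)
      -- No edge lies inside `rest`, so a vertex there has at most three neighbours, fewer than 2n.
      ... | there (there (there c∈)) with ws , q′ ← ∈⇒↭ c∈ =
        contradiction (≤-trans (*-monoʳ-≤ 2 2≤n) (≤-trans (fan⇒Big M refl) few)) λ { (s≤s (s≤s (s≤s ()))) }
        where
        deg-c : deg c rest ≡ 0
        deg-c = ≡.trans (deg-head q′) (m+n≡0⇒m≡0 (deg c ws) (≡.trans (≡.sym (E-↭ q′)) (proj₂ (proj₂ (proj₂ exact)))))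
        few : deg c all ≤ 3
        few = ≤-trans (≤-reflexive (deg-↭ c p))
          (+-mono-≤ (⟦⟧≤1 (adj G c c₁)) (+-mono-≤ (⟦⟧≤1 (adj G c c₂)) (+-mono-≤ (⟦⟧≤1 (adj G c c₃)) (≤-reflexive deg-c))))

  lower-bound : ∀ {n} → 2 ≤ n → Arrows G P₃ (Fan n) →
    6 * n ≤ 2 + edgeCount G ⊎ (4 * suc n ≤ edgeCount G × (Even n → 4 * suc n ≢ edgeCount G))
  lower-bound {n} 2≤n arr
    with c₁ , L , M , l ← arrows⇒fan arr {[]} identity
    with big₁ ← fan⇒Big {n} M l
    with other-big n (c₁ ∷ [])
  ... | inj₂ only = inj₂ (one-centre {n} (≤-trans (n≤1+n 1) 2≤n) arr big₁ only)
  ... | inj₁ (c₂ , c₂∉ , big₂) with other-big n (c₁ ∷ c₂ ∷ [])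
  ...   | inj₂ only = inj₁ (two-centres {n} (λ { refl → c₂∉ (here refl) }) arr big₁ big₂ only)
  ...   | inj₁ (c₃ , c₃∉ , big₃) = inj₁ (three-centres {n} 2≤n arr (λ { refl → c₂∉ (here refl) })
            (λ { refl → c₃∉ (here refl) }) (λ { refl → c₃∉ (there (here refl)) }) big₁ big₂ big₃)

-- The case n = 1: triangles under a red matching

module SingleTriangle {N : ℕ} (G : Graph N) where
  open Colourings G
  open Bounds G
  open FanExtraction G
  open DecMembership (Fin._≟_ {N}) using (_∈?_)

  Tri : (V → V) → List V → Set
  Tri f xs = ∃[ a ] ∃[ b ] ∃[ c ] a ∈ xs × b ∈ xs × c ∈ xs × Triangle f a b c

  TriRobust : List V → Set
  TriRobust xs = (m : Involution xs) → Tri (ι m) xs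

  Apex : (V → V) → V → List V → Set
  Apex f y ys = ∃₂ λ u w → u ∈ ys × w ∈ ys × Triangle f y u w

  Tri-↭ : ∀ {f xs ys} → xs ↭ ys → Tri f xs → Tri f ys
  Tri-↭ p (a , b , c , a∈ , b∈ , c∈ , t) = a , b , c , ∈-resp-↭ p a∈ , ∈-resp-↭ p b∈ , ∈-resp-↭ p c∈ , t

  TriRobust-↭ : ∀ {xs ys} → xs ↭ ys → TriRobust xs → TriRobust ys
  TriRobust-↭ p rob m = Tri-↭ p (rob (weaken (∈-resp-↭ (↭-sym p)) m))

  module _ {zs : List V} (m : Involution zs) where

    blue-sym : ∀ {a b} → ι m a ≢ b → ι m b ≢ a
    blue-sym {a} {b} ¬ab eq = ¬ab (≡.trans (cong (ι m) (≡.sym eq)) (involutive m b))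

    split : ∀ {y ys} → Tri (ι m) (y ∷ ys) → Tri (ι m) ys ⊎ Apex (ι m) y ys
    split (a , b , c , here refl , b∈ , c∈ , t@(mkTriangle ab ac bc ¬ab ¬ac ¬bc)) =
      inj₂ (b , c , ∈-tail b∈ (~⇒≢ ab ∘ ≡.sym) , ∈-tail c∈ (~⇒≢ ac ∘ ≡.sym) , t)
    split (a , b , c , there a∈ , here refl , c∈ , mkTriangle ab ac bc ¬ab ¬ac ¬bc) =
      inj₂ (a , c , a∈ , ∈-tail c∈ (~⇒≢ bc ∘ ≡.sym) , mkTriangle (~-sym ab) bc ac (blue-sym ¬ab) ¬bc ¬ac)
    split (a , b , c , there a∈ , there b∈ , here refl , mkTriangle ab ac bc ¬ab ¬ac ¬bc) =
      inj₂ (a , b , a∈ , b∈ , mkTriangle (~-sym ac) (~-sym bc) ab (blue-sym ¬ac) (blue-sym ¬bc) ¬ab)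
    split (a , b , c , there a∈ , there b∈ , there c∈ , t) = inj₁ (a , b , c , a∈ , b∈ , c∈ , t)

  1≤deg : ∀ {y u ys} → u ∈ ys → y ~ u → 1 ≤ deg y ys
  1≤deg {y} {ys = ys} u∈ y~u with deg y ys in eq
  ... | zero = contradiction y~u (deg≡0⇒≁ eq u∈)
  ... | suc _ = s≤s z≤n

  2≤deg : ∀ {y u w ys} → u ∈ ys → w ∈ ys → u ≢ w → y ~ u → y ~ w → 2 ≤ deg y ys
  2≤deg {y} {u} {w} u∈ w∈ u≢w y~u y~w with zs , p ← ∈⇒↭ u∈ =
    ≤-trans (s≤s (1≤deg {ys = zs} (∈-tail (∈-resp-↭ p w∈) (u≢w ∘ ≡.sym)) y~w)) (≤-reflexive (≡.sym (≡.trans (deg-↭ y p) (deg-~ zs y~u))))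

  1≤E : ∀ {u w ys} → u ∈ ys → w ∈ ys → u ~ w → 1 ≤ E ys
  1≤E {u} {w} u∈ w∈ u~w with zs , p ← ∈⇒↭ u∈ =
    ≤-trans (1≤deg {ys = zs} (∈-tail (∈-resp-↭ p w∈) (~⇒≢ u~w ∘ ≡.sym)) u~w)
      (≤-trans (m≤m+n _ (E zs)) (≤-reflexive (≡.sym (E-↭ p))))

  record Corner (x y z : V) : Set where
    constructor mkCorner
    field
      xy : x ~ y
      xz : x ~ z
      yz : y ~ z

  rotate : ∀ {x y z} → Corner x y z → Corner y z x
  rotate (mkCorner xy xz yz) = mkCorner yz (~-sym xy) (~-sym xz)

  Tri⇒↭ : ∀ {f xs} → Tri f xs → ∃[ a ] ∃[ b ] ∃[ c ] ∃[ ws ] xs ↭ a ∷ b ∷ c ∷ ws × Corner a b c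
  Tri⇒↭ (a , b , c , a∈ , b∈ , c∈ , mkTriangle ab ac bc _ _ _)
    with ys , p ← ∈⇒↭ a∈
    with zs , q ← ∈⇒↭ (∈-tail (∈-resp-↭ p b∈) (~⇒≢ ab ∘ ≡.sym))
    with ws , r ← ∈⇒↭ (∈-tail (∈-resp-↭ q (∈-tail (∈-resp-↭ p c∈) (~⇒≢ ac ∘ ≡.sym))) (~⇒≢ bc ∘ ≡.sym)) =
    a , b , c , ws , trans p (prep a (trans q (prep b r))) , mkCorner ab ac bc

  E-corner : ∀ {x y z} ws → Corner x y z → E (x ∷ y ∷ z ∷ ws) ≡ 3 + (deg x ws + deg y ws + deg z ws + E ws)
  E-corner {x} {y} {z} ws (mkCorner xy xz yz) rewrite xy | xz | yz = eq (deg x ws) (deg y ws) (deg z ws) (E ws)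
    where
    eq : ∀ a b c d → 2 + a + (1 + b + (c + d)) ≡ 3 + (a + b + c + d)
    eq = solve-∀

  Tri⇒3≤E : ∀ {f xs} → Tri f xs → 3 ≤ E xs
  Tri⇒3≤E t with a , b , c , ws , p , abc ← Tri⇒↭ t =
    ≤-trans (m≤m+n 3 _) (≤-reflexive (≡.sym (≡.trans (E-↭ p) (E-corner ws abc))))

  -- The blue triangle misses the red edge `yz`. If it avoids `y`, its three sides join the two
  -- edges at `y`; otherwise it avoids `z`, so `y` has three neighbours, and `zx` and the side `uw`
  -- are two further edges.
  second-triangle⇒5≤E : ∀ {x y z ws zs} (m : Involution zs) → Corner y z x → ι m y ≡ z →
    Tri (ι m) (y ∷ z ∷ x ∷ ws) → 5 ≤ E (y ∷ z ∷ x ∷ ws)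
  second-triangle⇒5≤E {x} {y} {z} {ws} m yzx@(mkCorner yz yx zx) red t with split m t
  ... | inj₁ t′ = +-mono-≤ (2≤deg {ys = z ∷ x ∷ ws} (here refl) (there (here refl)) (~⇒≢ zx) yz yx) (Tri⇒3≤E t′)
  ... | inj₂ (u , w , u∈ , w∈ , mkTriangle yu yw uw ¬yu ¬yw ¬uw) =
    +-mono-≤ {3} {_} {2}
      (≤-trans (s≤s (2≤deg (mem u∈ ¬yu) (mem w∈ ¬yw) (~⇒≢ uw) yu yw)) (≤-reflexive (≡.sym (deg-~ (x ∷ ws) yz))))
      (+-mono-≤ (1≤deg {ys = x ∷ ws} (here refl) zx) (1≤E (mem u∈ ¬yu) (mem w∈ ¬yw) uw))
    where
    mem : ∀ {u} → u ∈ z ∷ x ∷ ws → ι m y ≢ u → u ∈ x ∷ ws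
    mem u∈ ¬yu = ∈-tail u∈ λ { refl → ¬yu red }

  TriRobust⇒5≤E : ∀ {xs} → Unique xs → TriRobust xs → 5 ≤ E xs
  TriRobust⇒5≤E {xs} u rob with y , z , x , ws , p , yzx ← Tri⇒↭ (rob identity) =
    ≤-trans
      (second-triangle⇒5≤E (pair y z u′ identity) yzx (pair-x y z u′ identity) (TriRobust-↭ p rob (pair y z u′ identity)))
      (≤-reflexive (≡.sym (E-↭ p)))
    where
    u′ = Unique-resp-↭ p u

  -- With yz red, a vertex of degree 2 that meets it lies in no blue triangle.
  two-thin⇒8≤E : ∀ {y z x ws} → Unique (y ∷ z ∷ x ∷ ws) → TriRobust (y ∷ z ∷ x ∷ ws) → Corner y z x →
    deg y ws ≡ 0 → deg z ws ≡ 0 → 8 ≤ E (y ∷ z ∷ x ∷ ws)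
  two-thin⇒8≤E {y} {z} {x} {ws} u rob yzx@(mkCorner yz yx zx) dy dz = begin
    8                                  ≤⟨ +-monoʳ-≤ 3 (TriRobust⇒5≤E (Unique-tail (Unique-tail u)) rest) ⟩
    3 + (deg x ws + E ws)              ≡⟨ cong₂ (λ s t → 3 + (s + t + deg x ws + E ws)) dy dz ⟨
    3 + (deg y ws + deg z ws + deg x ws + E ws) ≡⟨ E-corner ws yzx ⟨
    E (y ∷ z ∷ x ∷ ws)                 ∎
    where
    open ≤-Reasoning
    no-apex : ∀ {f t s} → deg t ws ≡ 0 → f t ≡ s → ∀ {as} → (∀ {a} → a ∈ as → a ∈ s ∷ x ∷ ws) → ¬ Apex f t as
    no-apex {f} {t} {s} d red sub (v , w , v∈ , w∈ , mkTriangle tv tw vw ¬tv ¬tw _) = go (mem v∈ ¬tv) (mem w∈ ¬tw)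
      where
      mem : ∀ {a} → a ∈ _ → f t ≢ a → a ∈ x ∷ ws
      mem a∈ ¬ta = ∈-tail (sub a∈) λ { refl → ¬ta red }
      go : v ∈ x ∷ ws → w ∈ x ∷ ws → ⊥
      go (there v∈) _ = deg≡0⇒≁ d v∈ tv
      go (here refl) (here refl) = ~⇒≢ vw refl
      go (here refl) (there w∈) = deg≡0⇒≁ d w∈ tw
    rest : TriRobust (x ∷ ws)
    rest m with split m′ (rob m′)
      where m′ = pair y z u m
    ... | inj₂ apex = ⊥-elim (no-apex dy (pair-x y z u m) id apex)
    ... | inj₁ t with split (pair y z u m) t
    ...   | inj₂ apex = ⊥-elim (no-apex dz (pair-y y z u m) there apex)
    ...   | inj₁ (a , b , c , a∈ , b∈ , c∈ , mkTriangle ab ac bc ¬ab ¬ac ¬bc) =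
      a , b , c , a∈ , b∈ , c∈ , mkTriangle ab ac bc (¬ab ∘ old a∈) (¬ac ∘ old a∈) (¬bc ∘ old b∈)
      where
      old : ∀ {a b} → a ∈ x ∷ ws → ι m a ≡ b → ι (pair y z u m) a ≡ b
      old a∈ = ≡.trans (pair-z y z u m (λ { refl → ∉-head u (there a∈) }) (λ { refl → ∉-head (Unique-tail u) a∈ }))

  -- The red edges cx and yz meet every triangle inside {c, x, y, z}.
  far-triangle : ∀ {c x y z ws} → Unique (c ∷ x ∷ y ∷ z ∷ ws) → TriRobust (c ∷ x ∷ y ∷ z ∷ ws) → Corner x y z →
    deg y ws ≡ 0 → deg z ws ≡ 0 → 5 ≤ E (x ∷ y ∷ z ∷ ws) ⊎ (2 ≤ deg c ws × 1 ≤ E ws)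
  far-triangle {c} {x} {y} {z} {ws} u rob xyz dy dz = cases (split m (rob m))
    where
    u′ = Unique-tail (Unique-tail u)
    m₀ = pair y z u′ identity
    m = pair c x u m₀
    y≢c : y ≢ c
    y≢c refl = ∉-head u (there (here refl))
    y≢x : y ≢ x
    y≢x refl = ∉-head (Unique-tail u) (here refl)
    z≢c : z ≢ c
    z≢c refl = ∉-head u (there (there (here refl)))
    z≢x : z ≢ x
    z≢x refl = ∉-head (Unique-tail u) (there (here refl))
    y-red : ι m y ≡ z
    y-red = ≡.trans (pair-z c x u m₀ y≢c y≢x) (pair-x y z u′ identity)
    z-red : ι m z ≡ y
    z-red = ≡.trans (pair-z c x u m₀ z≢c z≢x) (pair-y y z u′ identity)
    s : x ∷ y ∷ z ∷ ws ↭ y ∷ z ∷ x ∷ ws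
    s = trans (swap x y refl) (prep y (swap x z refl))
    cases : Tri (ι m) (x ∷ y ∷ z ∷ ws) ⊎ Apex (ι m) c (x ∷ y ∷ z ∷ ws) → 5 ≤ E (x ∷ y ∷ z ∷ ws) ⊎ (2 ≤ deg c ws × 1 ≤ E ws)
    cases (inj₁ t) = inj₁ (≤-trans (second-triangle⇒5≤E m (rotate xyz) y-red (Tri-↭ s t)) (≤-reflexive (≡.sym (E-↭ s))))
    cases (inj₂ (v , w , v∈ , w∈ , mkTriangle cv cw vw ¬cv ¬cw ¬vw)) = inj₂ (inside (mem v∈ ¬cv) (mem w∈ ¬cw))
      where
      mem : ∀ {a} → a ∈ x ∷ y ∷ z ∷ ws → ι m c ≢ a → a ∈ y ∷ z ∷ ws
      mem a∈ ¬ca = ∈-tail a∈ λ { refl → ¬ca (pair-x c x u m₀) }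
      inside : v ∈ y ∷ z ∷ ws → w ∈ y ∷ z ∷ ws → 2 ≤ deg c ws × 1 ≤ E ws
      inside (here refl) (here refl) = contradiction refl (~⇒≢ vw)
      inside (here refl) (there (here refl)) = contradiction y-red ¬vw
      inside (here refl) (there (there w∈)) = contradiction vw (deg≡0⇒≁ dy w∈)
      inside (there (here refl)) (here refl) = contradiction z-red ¬vw
      inside (there (here refl)) (there (here refl)) = contradiction refl (~⇒≢ vw)
      inside (there (here refl)) (there (there w∈)) = contradiction vw (deg≡0⇒≁ dz w∈)
      inside (there (there v∈)) (here refl) = contradiction (~-sym vw) (deg≡0⇒≁ dy v∈)
      inside (there (there v∈)) (there (here refl)) = contradiction (~-sym vw) (deg≡0⇒≁ dz v∈)
      inside (there (there v∈)) (there (there w∈)) = 2≤deg v∈ w∈ (~⇒≢ vw) cv cw , 1≤E v∈ w∈ vw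

  -- Five edges away from `c` suffice together with the three at `c`. Failing that, at most one edge
  -- besides the triangle avoids `c`. If it meets the triangle, the red edges from `c` and inside
  -- the triangle leave no room for a blue one. If not, either two corners have degree 2, or `c` has
  -- two neighbours in the triangle and two outside it.
  disjoint-triangle⇒8≤E : ∀ {c x y z ws} → Unique (c ∷ x ∷ y ∷ z ∷ ws) → TriRobust (c ∷ x ∷ y ∷ z ∷ ws) → Corner x y z →
    3 ≤ deg c (x ∷ y ∷ z ∷ ws) → 8 ≤ E (c ∷ x ∷ y ∷ z ∷ ws)
  disjoint-triangle⇒8≤E {c} {x} {y} {z} {ws} u rob xyz 3≤d with 5 ≤? E (x ∷ y ∷ z ∷ ws)
  ... | yes 5≤ = +-mono-≤ 3≤d 5≤
  ... | no 5≰ = cases (deg x ws) (deg y ws) (deg z ws) (E ws) refl refl refl refl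
      (+-cancelˡ-≤ 3 _ _ (≤-trans (≤-reflexive (≡.sym (E-corner ws xyz))) (≤-pred (≰⇒> 5≰))))
    where
    r₁ : c ∷ x ∷ y ∷ z ∷ ws ↭ c ∷ y ∷ z ∷ x ∷ ws
    r₁ = prep c (trans (swap x y refl) (prep y (swap x z refl)))
    r₂ : c ∷ x ∷ y ∷ z ∷ ws ↭ c ∷ z ∷ x ∷ y ∷ ws
    r₂ = prep c (trans (prep x (swap y z refl)) (swap x z refl))
    outer : ∀ {x y z} → c ∷ x ∷ y ∷ z ∷ ws ↭ x ∷ y ∷ z ∷ c ∷ ws
    outer {x} {y} {z} = trans (swap c x refl) (prep x (trans (swap c y refl) (prep y (swap c z refl))))
    whole = c ∷ x ∷ y ∷ z ∷ ws
    thin : ∀ {x y z} → whole ↭ c ∷ x ∷ y ∷ z ∷ ws → Corner x y z → deg x ws ≡ 0 → deg y ws ≡ 0 →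
      adj G c x ≡ false → adj G c y ≡ false → 8 ≤ E whole
    thin {x} {y} r xyz dx dy cx cy = ≤-trans
      (two-thin⇒8≤E (Unique-resp-↭ s u) (TriRobust-↭ s rob) xyz
        (cong₂ (λ b n → ⟦ b ⟧ + n) (≡.trans (sym G x c) cx) dx) (cong₂ (λ b n → ⟦ b ⟧ + n) (≡.trans (sym G y c) cy) dy))
      (≤-reflexive (≡.sym (E-↭ s)))
      where s = trans r outer
    one-fat : ∀ {x y z} → whole ↭ c ∷ x ∷ y ∷ z ∷ ws → Corner x y z → deg y ws ≡ 0 → deg z ws ≡ 0 → E ws ≡ 0 → 8 ≤ E whole
    one-fat {x′} {y′} {z′} r xyz′ dy dz e with far-triangle (Unique-resp-↭ r u) (TriRobust-↭ r rob) xyz′ dy dz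
    ... | inj₁ 5≤ = ≤-trans (+-mono-≤ (≤-trans 3≤d (≤-reflexive deg-c)) 5≤) (≤-reflexive (≡.sym (E-↭ r)))
      where
      deg-c : deg c (x ∷ y ∷ z ∷ ws) ≡ deg c (x′ ∷ y′ ∷ z′ ∷ ws)
      deg-c = ≡.trans (≡.sym (deg-self c (x ∷ y ∷ z ∷ ws))) (deg-head r)
    ... | inj₂ (_ , 1≤) = contradiction (≤-trans 1≤ (≤-reflexive e)) λ ()
    none-fat : deg x ws ≡ 0 → deg y ws ≡ 0 → deg z ws ≡ 0 → 8 ≤ E whole
    none-fat dx dy dz with far-triangle u rob xyz dy dz
    ... | inj₁ 5≤ = +-mono-≤ 3≤d 5≤
    ... | inj₂ (2≤ , 1≤) = by-adjacency (adj G c x) (adj G c y) (adj G c z) refl refl refl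
      where
      -- Four edges at `c`, then the triangle and one edge inside `ws`.
      spread : 2 ≤ ⟦ adj G c x ⟧ + (⟦ adj G c y ⟧ + ⟦ adj G c z ⟧) → 8 ≤ E whole
      spread h = +-mono-≤ {4} {_} {4}
        (≤-trans (+-mono-≤ h 2≤) (≤-reflexive (eq ⟦ adj G c x ⟧ ⟦ adj G c y ⟧ ⟦ adj G c z ⟧ (deg c ws))))
        (≤-trans (+-monoʳ-≤ 3 (≤-trans 1≤ (m≤n+m (E ws) (deg x ws + deg y ws + deg z ws)))) (≤-reflexive (≡.sym (E-corner ws xyz))))
        where
        eq : ∀ p q r s → p + (q + r) + s ≡ p + (q + (r + s))
        eq = solve-∀
      by-adjacency : ∀ p q r → adj G c x ≡ p → adj G c y ≡ q → adj G c z ≡ r → 8 ≤ E whole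
      by-adjacency false false _ cx cy cz = thin refl xyz dx dy cx cy
      by-adjacency false true false cx cy cz = thin r₂ (rotate (rotate xyz)) dz dx cz cx
      by-adjacency true false false cx cy cz = thin r₁ (rotate xyz) dy dz cy cz
      by-adjacency false true true cx cy cz = spread (≤-reflexive (≡.sym (cong₂ _+_ (cong ⟦_⟧ cx) (cong₂ _+_ (cong ⟦_⟧ cy) (cong ⟦_⟧ cz)))))
      by-adjacency true false true cx cy cz = spread (≤-reflexive (≡.sym (cong₂ _+_ (cong ⟦_⟧ cx) (cong₂ _+_ (cong ⟦_⟧ cy) (cong ⟦_⟧ cz)))))
      by-adjacency true true _ cx cy cz = spread (≤-trans (+-mono-≤ {1} {1} ≤-refl (m≤m+n 1 ⟦ adj G c z ⟧))
        (≤-reflexive (≡.sym (cong₂ (λ s t → ⟦ s ⟧ + (⟦ t ⟧ + ⟦ adj G c z ⟧)) cx cy))))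
    cases : ∀ dx dy dz e → deg x ws ≡ dx → deg y ws ≡ dy → deg z ws ≡ dz → E ws ≡ e → dx + dy + dz + e ≤ 1 → 8 ≤ E whole
    cases 0 0 0 _ dx dy dz _ _ = none-fat dx dy dz
    cases 1 0 0 0 dx dy dz e _ = one-fat refl xyz dy dz e
    cases 0 1 0 0 dx dy dz e _ = one-fat r₁ (rotate xyz) dz dx e
    cases 0 0 1 0 dx dy dz e _ = one-fat r₂ (rotate (rotate xyz)) dx dy e
    cases (suc (suc _)) _ _ _ _ _ _ _ (s≤s ())
    cases 1 (suc _) _ _ _ _ _ _ (s≤s ())
    cases 1 0 (suc _) _ _ _ _ _ (s≤s ())
    cases 1 0 0 (suc _) _ _ _ _ (s≤s ())
    cases 0 (suc (suc _)) _ _ _ _ _ _ (s≤s ())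
    cases 0 1 (suc _) _ _ _ _ _ (s≤s ())
    cases 0 1 0 (suc _) _ _ _ _ (s≤s ())
    cases 0 0 (suc (suc _)) _ _ _ _ _ (s≤s ())
    cases 0 0 1 (suc _) _ _ _ _ (s≤s ())

  -- With the identity as involution no edge is red, so `Triangle id` is just a triangle of `G`.
  clique : ∀ {a b c} → a ~ b → a ~ c → b ~ c → Triangle id a b c
  clique ab ac bc = mkTriangle ab ac bc (~⇒≢ ab) (~⇒≢ ac) (~⇒≢ bc)

  Tri⇒clique : ∀ {f xs} → Tri f xs → Tri id xs
  Tri⇒clique (a , b , c , a∈ , b∈ , c∈ , mkTriangle ab ac bc _ _ _) = a , b , c , a∈ , b∈ , c∈ , clique ab ac bc

  clique? : ∀ xs → Dec (Tri id xs)
  clique? xs = Fin.any? λ a → Fin.any? λ b → Fin.any? λ c → (a ∈? xs) ×-dec (b ∈? xs) ×-dec (c ∈? xs) ×-dec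
    Dec.map′ (λ { (ab , ac , bc) → clique ab ac bc }) (λ { (mkTriangle ab ac bc _ _ _) → ab , ac , bc })
      ((adj G a b Bool.≟ true) ×-dec (adj G a c Bool.≟ true) ×-dec (adj G b c Bool.≟ true))

  unique : Unique all
  unique = Unique.allFin⁺ N

  -- If no triangle avoids `c`, then every blue triangle is a fan centred at `c`, and the
  -- neighbourhood bound at n = 1 gives 8. Otherwise a triangle disjoint from `c` is available.
  degree-3⇒8≤edgeCount : ∀ {c} → TriRobust all → 3 ≤ deg c all → 8 ≤ edgeCount G
  degree-3⇒8≤edgeCount {c} robust 3≤d with rest , p ← ∈⇒↭ (∈-allFin c) with clique? rest
  ... | yes t with x , y , z , ws , q , xyz ← Tri⇒↭ t =
    ≤-trans (disjoint-triangle⇒8≤E (Unique-resp-↭ s unique) (TriRobust-↭ s robust) xyz (≤-trans 3≤d (≤-reflexive (deg-head s))))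
      (≤-reflexive (≡.sym (E-all s)))
    where
    s = trans p (prep c q)
  ... | no ¬t = ≤-trans (proj₁ bound) (≤-trans (cost-nbrs c rest) (≤-reflexive (≡.sym (E-all p))))
    where
    xs = nbrs c rest
    at-c : (m : Involution all) → ∃[ L ] IsMatching (Triangle (ι m) c) L × length L ≡ 1
    at-c m with split m (Tri-↭ p (robust m))
    ... | inj₁ t = ⊥-elim (¬t (Tri⇒clique t))
    ... | inj₂ (u , w , _ , _ , t@(mkTriangle _ _ uw _ _ _)) = (u , w) ∷ [] , ((~⇒≢ uw ∷ []) ∷ [] ∷ [] , t ∷ []) , refl
    bound = VertexRobust⇒4n+4≤cost (length xs) xs ≤-refl (Unique.filter⁺ _ (Unique-tail (Unique-resp-↭ p unique)))
      (≤-trans (s≤s z≤n) (≤-trans 3≤d (≤-reflexive (≡.trans (deg-head p) (≡.sym (length-nbrs c rest)))))) ≤-refl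
      (centre⇒VertexRobust p at-c)

  arrows⇒TriRobust : Arrows G P₃ (Fan 1) → TriRobust all
  arrows⇒TriRobust arr m with arrows⇒fan {1} arr m
  ... | c , (a , b) ∷ [] , (_ , t ∷ []) , refl = c , a , b , ∈-allFin c , ∈-allFin a , ∈-allFin b , t

  triangle-lower-bound : Arrows G P₃ (Fan 1) → 8 ≤ edgeCount G
  triangle-lower-bound arr
    with robust ← arrows⇒TriRobust arr
    with x , y , z , ws , p , xyz@(mkCorner xy xz yz) ← Tri⇒↭ (robust identity)
    with 3 ≤? deg x all | 3 ≤? deg y all
  ... | yes 3≤ | _ = degree-3⇒8≤edgeCount robust 3≤
  ... | no _ | yes 3≤ = degree-3⇒8≤edgeCount robust 3≤
  ... | no x<3 | no y<3 = ≤-trans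
    (two-thin⇒8≤E (Unique-resp-↭ p unique) (TriRobust-↭ p robust) xyz (thin p xy xz x<3)
      (thin (trans p (swap x y refl)) (~-sym xy) yz y<3))
    (≤-reflexive (≡.sym (E-all p)))
    where
    thin : ∀ {a b c} → all ↭ a ∷ b ∷ c ∷ ws → a ~ b → a ~ c → ¬ 3 ≤ deg a all → deg a ws ≡ 0
    thin {a} {b} {c} q ab ac a<3 = n≤0⇒n≡0 (≤-pred (≤-pred (≤-trans
      (≤-reflexive (≡.sym (≡.trans (deg-head q) (≡.trans (deg-~ (c ∷ ws) ab) (cong suc (deg-~ ws ac)))))) (≤-pred (≰⇒> a<3)))))

-- Constructions

NoRedP₃ : ∀ {p} → Graph p → (Fin p → Fin p → Bool) → Set
NoRedP₃ G c = ∀ {x y z} → y ≢ z → adj G x y ≡ true → adj G x z ≡ true → c x y ≡ true → c x z ≡ true → ⊥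

redP₃-or-not : ∀ {p} (G : Graph p) (c : Colouring p) → HasColouredCopy G c true P₃ ⊎ NoRedP₃ G (proj₁ c)
redP₃-or-not G (c , c-sym) with Fin.any? (λ x → Fin.any? λ y → Fin.any? λ z →
  ¬? (y Fin.≟ z) ×-dec (adj G x y Bool.≟ true) ×-dec (adj G x z Bool.≟ true) ×-dec (c x y Bool.≟ true) ×-dec (c x z Bool.≟ true))
... | no ¬red = inj₂ λ y≢z xy xz r s → ¬red (_ , _ , _ , y≢z , xy , xz , r , s)
... | yes (x , y , z , y≢z , xy , xz , r , s) = inj₁ (f , (λ {a} {b} → f-injective a b) , edge)
  where
  x≢ : ∀ {w} → adj G x w ≡ true → x ≢ w
  x≢ xw refl = true≢false (≡.trans (≡.sym xw) (irrefl G x))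
  f : Fin 3 → Fin _
  f 0F = y
  f 1F = x
  f 2F = z
  f-injective : ∀ a b → f a ≡ f b → a ≡ b
  f-injective 0F 0F _ = refl
  f-injective 0F 1F eq = contradiction (≡.sym eq) (x≢ xy)
  f-injective 0F 2F eq = contradiction eq y≢z
  f-injective 1F 0F eq = contradiction eq (x≢ xy)
  f-injective 1F 1F _ = refl
  f-injective 1F 2F eq = contradiction eq (x≢ xz)
  f-injective 2F 0F eq = contradiction (≡.sym eq) y≢z
  f-injective 2F 1F eq = contradiction (≡.sym eq) (x≢ xz)
  f-injective 2F 2F _ = refl
  edge : ∀ a b → adj P₃ a b ≡ true → adj G (f a) (f b) ≡ true × c (f a) (f b) ≡ true
  edge 0F 1F _ = ≡.trans (sym G y x) xy , ≡.trans (c-sym y x) r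
  edge 1F 0F _ = xy , r
  edge 1F 2F _ = xz , s
  edge 2F 1F _ = ≡.trans (sym G z x) xz , ≡.trans (c-sym z x) s

-- Positions past the end of the list yield the default value d.
nth : A → List A → ℕ → A
nth d [] _ = d
nth d (x ∷ xs) zero = x
nth d (x ∷ xs) (suc i) = nth d xs i

nth-All : ∀ {P : A → Set} {d xs i} → All P xs → i < length xs → P (nth d xs i)
nth-All {i = zero} (p ∷ _) _ = p
nth-All {i = suc i} (_ ∷ ps) (s≤s i<) = nth-All ps i<

nth-injective : ∀ {d : A} {xs i j} → Unique xs → i < length xs → j < length xs → nth d xs i ≡ nth d xs j → i ≡ j
nth-injective {i = zero} {zero} _ _ _ _ = refl
nth-injective {i = zero} {suc j} (x∉ ∷ _) _ (s≤s j<) eq = contradiction eq (nth-All x∉ j<)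
nth-injective {i = suc i} {zero} (x∉ ∷ _) (s≤s i<) _ eq = contradiction (≡.sym eq) (nth-All x∉ i<)
nth-injective {i = suc i} {suc j} (_ ∷ u) (s≤s i<) (s≤s j<) eq = cong suc (nth-injective u i< j< eq)

∨-true : ∀ {a b} → a ∨ b ≡ true → a ≡ true ⊎ b ≡ true
∨-true {true} _ = inj₁ refl
∨-true {false} eq = inj₂ eq

∧-true : ∀ {a b} → a ∧ b ≡ true → a ≡ true × b ≡ true
∧-true {true} eq = refl , eq

≡ᵇ-true : ∀ {m n} → (m ≡ᵇ n) ≡ true → m ≡ n
≡ᵇ-true {m} {n} eq = ≡ᵇ⇒≡ m n (subst Bool.T (≡.sym eq) _)

nth-verts : ∀ {R : A → A → Set} {d} x L i → isOdd i ≡ true → i < 2 * length L → All (uncurry R) L →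
  R (nth d (x ∷ verts L) i) (nth d (x ∷ verts L) (suc i))
nth-verts x [] i odd () rs
nth-verts x ((u , v) ∷ L) (suc zero) odd i< (r ∷ _) = r
nth-verts x ((u , v) ∷ L) (suc (suc i)) odd i< (_ ∷ rs) =
  nth-verts v L i (≡.trans (≡.sym (not-involutive (isOdd i))) odd) (≤-pred (≤-pred (≤-trans i< (≤-reflexive (*-suc 2 (length L)))))) rs

module _ {p : ℕ} (G : Graph p) (c : Colouring p) where

  BlueEdge : Fin p → Fin p → Set
  BlueEdge a b = adj G a b ≡ true × proj₁ c a b ≡ false

  BlueTriangle : Fin p → Fin p → Fin p → Set
  BlueTriangle z a b = BlueEdge z a × BlueEdge z b × BlueEdge a b

  -- The list `z ∷ verts L` follows the numbering of `Fan`: position 0 is the centre, 2k + 1 and 2k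
  -- + 2 are a pair. Surplus pairs lie beyond the positions used, and the default value is never
  -- reached.
  matching⇒fan : ∀ {n z L} → IsMatching (BlueTriangle z) L → n ≤ length L → HasColouredCopy G c false (Fan n)
  matching⇒fan {n} {z} {L} (u , ts) n≤ = f , injective , λ a b → edge (toℕ a) (toℕ b) (bound a) (bound b)
    where
    xs = z ∷ verts L
    spokes : All (BlueEdge z) (verts L)
    spokes = All-verts (λ { (za , zb , _) → za , zb }) ts
    uxs : Unique xs
    uxs = All.map (λ { (za , _) refl → true≢false (≡.trans (≡.sym za) (irrefl G z)) }) spokes ∷ u
    bound : ∀ (i : Fin (suc (2 * n))) → toℕ i < length xs
    bound i = ≤-trans (Fin.toℕ<n i) (s≤s (≤-trans (*-monoʳ-≤ 2 n≤) (≤-reflexive (≡.sym (length-verts L)))))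
    f : Fin (suc (2 * n)) → Fin p
    f i = nth z xs (toℕ i)
    injective : Injective _≡_ _≡_ f
    injective {i} {j} eq = Fin.toℕ-injective (nth-injective uxs (bound i) (bound j) eq)
    flip : ∀ {a b} → BlueEdge a b → BlueEdge b a
    flip {a} {b} (e , blue) = ≡.trans (sym G b a) e , ≡.trans (proj₂ c b a) blue
    rim : ∀ {a} → isOdd a ≡ true → suc a < length xs → BlueEdge (nth z xs a) (nth z xs (suc a))
    rim odd a< = nth-verts {R = BlueEdge} z L _ odd (≤-trans (≤-pred a<) (≤-reflexive (length-verts L))) (All.map (λ { (_ , _ , ab) → ab }) ts)
    edge : ∀ a b → a < length xs → b < length xs → fanAdj a b ≡ true → BlueEdge (nth z xs a) (nth z xs b)
    edge zero (suc b) _ (s≤s b<) _ = nth-All spokes b<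
    edge (suc a) zero (s≤s a<) _ _ = flip (nth-All spokes a<)
    edge (suc a) (suc b) a< b< e with ∨-true e
    ... | inj₁ e₁ with odd , eq ← ∧-true {isOdd (suc a)} e₁ with refl ← ≡ᵇ-true {b} {suc a} eq = rim odd b<
    ... | inj₂ e₂ with odd , eq ← ∧-true {isOdd (suc b)} e₂ with refl ← ≡ᵇ-true {a} {suc b} eq = flip (rim odd a<)

-- Building graphs from cones and four-cycles

addVertex : ∀ {p} → Graph p → (Fin p → Bool) → Graph (suc p)
addVertex {p} H S = record { adj = a ; sym = s ; irrefl = i }
  where
  a : Fin (suc p) → Fin (suc p) → Bool
  a Fin.zero Fin.zero = false
  a Fin.zero (Fin.suc j) = S j
  a (Fin.suc i) Fin.zero = S i
  a (Fin.suc i) (Fin.suc j) = adj H i j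
  s : ∀ i j → a i j ≡ a j i
  s Fin.zero Fin.zero = refl
  s Fin.zero (Fin.suc j) = refl
  s (Fin.suc i) Fin.zero = refl
  s (Fin.suc i) (Fin.suc j) = sym H i j
  i : ∀ i → a i i ≡ false
  i Fin.zero = refl
  i (Fin.suc i) = irrefl H i

size : ∀ {p} → (Fin p → Bool) → ℕ
size {zero} S = 0
size {suc p} S = ⟦ S Fin.zero ⟧ + size (S ∘ Fin.suc)

everything nothing : ∀ {p} → Fin p → Bool
everything _ = true
nothing _ = false

size-everything : ∀ p → size {p} everything ≡ p
size-everything zero = refl
size-everything (suc p) = cong suc (size-everything p)

size-nothing : ∀ p → size {p} nothing ≡ 0
size-nothing zero = refl
size-nothing (suc p) = size-nothing p

degIn-tabulate : ∀ {p} (R : A → A → Bool) x (f : Fin p → A) → degIn R x (tabulate f) ≡ size (R x ∘ f)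
degIn-tabulate {p = zero} R x f = refl
degIn-tabulate {p = suc p} R x f = cong (⟦ R x (f Fin.zero) ⟧ +_) (degIn-tabulate R x (f ∘ Fin.suc))

degIn-map : ∀ {B : Set} (R : A → A → Bool) (f : B → A) x xs → degIn R (f x) (map f xs) ≡ degIn (λ a b → R (f a) (f b)) x xs
degIn-map R f x [] = refl
degIn-map R f x (y ∷ ys) = cong (⟦ R (f x) (f y) ⟧ +_) (degIn-map R f x ys)

edgesIn-map : ∀ {B : Set} (R : A → A → Bool) (f : B → A) xs → edgesIn R (map f xs) ≡ edgesIn (λ a b → R (f a) (f b)) xs
edgesIn-map R f [] = refl
edgesIn-map R f (x ∷ xs) = cong₂ _+_ (degIn-map R f x xs) (edgesIn-map R f xs)

edgeCount-addVertex : ∀ {p} (H : Graph p) S → edgeCount (addVertex H S) ≡ size S + edgeCount H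
edgeCount-addVertex {p} H S = ≡.trans (edgeCount≡edgesIn (addVertex H S)) (cong₂ _+_
  (degIn-tabulate (adj (addVertex H S)) Fin.zero Fin.suc)
  (≡.trans (cong (edgesIn (adj (addVertex H S))) (≡.sym (map-tabulate id Fin.suc)))
    (≡.trans (edgesIn-map (adj (addVertex H S)) Fin.suc (allFin p)) (≡.sym (edgeCount≡edgesIn H)))))

cone : ∀ {p} → Graph p → Graph (suc p)
cone H = addVertex H everything

edgeCount-cone : ∀ {p} (H : Graph p) → edgeCount (cone H) ≡ p + edgeCount H
edgeCount-cone {p} H = ≡.trans (edgeCount-addVertex H everything) (cong (_+ edgeCount H) (size-everything p))

first first-third : ∀ {p} → Fin (suc p) → Bool
first Fin.zero = true
first (Fin.suc _) = false
first-third Fin.zero = true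
first-third (Fin.suc Fin.zero) = false
first-third (Fin.suc (Fin.suc Fin.zero)) = true
first-third (Fin.suc (Fin.suc (Fin.suc _))) = false

-- Built from the inside out: 3 is isolated, 2 is joined to 3, 1 to 2, and 0 to 1 and 3. This is the
-- cycle 0, 1, 2, 3, disjoint from `H`.
addC₄ : ∀ {p} → Graph p → Graph (4 + p)
addC₄ H = addVertex (addVertex (addVertex (addVertex H nothing) first) first) first-third

shift₄ : ∀ {p} → Fin p → Fin (4 + p)
shift₄ i = Fin.suc (Fin.suc (Fin.suc (Fin.suc i)))

shift₄-injective : ∀ {p} {i j : Fin p} → shift₄ i ≡ shift₄ j → i ≡ j
shift₄-injective refl = refl

edgeCount-addC₄ : ∀ {p} (H : Graph p) → edgeCount (addC₄ H) ≡ 4 + edgeCount H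
edgeCount-addC₄ {p} H
  rewrite edgeCount-addVertex (addVertex (addVertex (addVertex H nothing) first) first) first-third
        | edgeCount-addVertex (addVertex (addVertex H nothing) first) first
        | edgeCount-addVertex (addVertex H nothing) first
        | edgeCount-addVertex H nothing
        | size-nothing p = refl

HasBlueMatching : ∀ {p} → ℕ → Graph p → Set
HasBlueMatching {p} s H = (c : Colouring p) → NoRedP₃ H (proj₁ c) → ∃[ L ] IsMatching (BlueEdge H c) L × length L ≡ s

verts-map : ∀ {B : Set} (f : A → B) L → verts (map (λ { (a , b) → f a , f b }) L) ≡ map f (verts L)
verts-map f [] = refl
verts-map f ((a , b) ∷ L) = cong (λ xs → f a ∷ f b ∷ xs) (verts-map f L)

-- The cycle is the union of the perfect matchings 01, 23 and 12, 03. Each edge of one meets both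
-- edges of the other, so a red edge in the first makes the second entirely blue.
addC₄-HasBlueMatching : ∀ {p s} {H : Graph p} → HasBlueMatching s H → HasBlueMatching (2 + s) (addC₄ H)
addC₄-HasBlueMatching {p} {s} {H} robust (c , c-sym) no-red
  with L , (u , es) , refl ← robust ((λ i j → c (shift₄ i) (shift₄ j)) , λ i j → c-sym (shift₄ i) (shift₄ j))
                                    (λ y≢z → no-red (y≢z ∘ shift₄-injective)) =
  four-cycle (c 0F 1F) (c 2F 3F) refl refl
  where
  L′ = map (λ { (a , b) → shift₄ a , shift₄ b }) L
  B = BlueEdge (addC₄ H) (c , c-sym)
  u′ : Unique (verts L′)
  u′ = subst Unique (≡.sym (verts-map shift₄ L)) (Unique.map⁺ shift₄-injective u)
  new : ∀ {x} → (∀ i → x ≢ shift₄ i) → All (x ≢_) (verts L′)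
  new {x} x≢ = subst (All (x ≢_)) (≡.sym (verts-map shift₄ L)) (All.map⁺ (All.universal x≢ (verts L)))
  es′ : All (uncurry B) L′
  es′ = All.map⁺ (All.map id es)
  l : 2 + length L′ ≡ 2 + length L
  l = cong (2 +_) (length-map _ L)
  blue : ∀ {x y z} → y ≢ z → adj (addC₄ H) x y ≡ true → adj (addC₄ H) x z ≡ true → c x y ≡ true → c x z ≡ false
  blue y≢z xy xz red = ≢true⇒≡false (no-red y≢z xy xz red)
  other-pair : c 1F 2F ≡ false → c 0F 3F ≡ false → ∃[ M ] IsMatching B M × length M ≡ 2 + length L
  other-pair b₁ b₂ = (1F , 2F) ∷ (0F , 3F) ∷ L′ ,
    (((λ ()) ∷ (λ ()) ∷ (λ ()) ∷ new λ _ ()) ∷ ((λ ()) ∷ (λ ()) ∷ new λ _ ()) ∷ ((λ ()) ∷ new λ _ ()) ∷ (new λ _ ()) ∷ u′ ,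
     (refl , b₁) ∷ (refl , b₂) ∷ es′) , l
  four-cycle : ∀ r s → c 0F 1F ≡ r → c 2F 3F ≡ s → ∃[ M ] IsMatching B M × length M ≡ 2 + length L
  four-cycle false false r s = (0F , 1F) ∷ (2F , 3F) ∷ L′ ,
    (((λ ()) ∷ (λ ()) ∷ (λ ()) ∷ new λ _ ()) ∷ ((λ ()) ∷ (λ ()) ∷ new λ _ ()) ∷ ((λ ()) ∷ new λ _ ()) ∷ (new λ _ ()) ∷ u′ ,
     (refl , r) ∷ (refl , s) ∷ es′) , l
  four-cycle true _ r s =
    other-pair (blue {y = 0F} (λ ()) refl refl (≡.trans (c-sym 1F 0F) r)) (blue {y = 1F} (λ ()) refl refl r)
  four-cycle false true r s =
    other-pair (≡.trans (c-sym 1F 2F) (blue {y = 3F} (λ ()) refl refl s))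
      (≡.trans (c-sym 0F 3F) (blue {y = 2F} (λ ()) refl refl (≡.trans (c-sym 3F 2F) s)))

four-cycles : ∀ k {p} → Graph p → Graph (k * 4 + p)
four-cycles zero H = H
four-cycles (suc k) H = addC₄ (four-cycles k H)

edgeCount-four-cycles : ∀ k {p} (H : Graph p) → edgeCount (four-cycles k H) ≡ k * 4 + edgeCount H
edgeCount-four-cycles zero H = refl
edgeCount-four-cycles (suc k) H = ≡.trans (edgeCount-addC₄ (four-cycles k H)) (cong (4 +_) (edgeCount-four-cycles k H))

four-cycles-HasBlueMatching : ∀ k {p s} {H : Graph p} → HasBlueMatching s H → HasBlueMatching (k * 2 + s) (four-cycles k H)
four-cycles-HasBlueMatching zero robust = robust
four-cycles-HasBlueMatching (suc k) robust = addC₄-HasBlueMatching (four-cycles-HasBlueMatching k robust)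

emptyGraph : Graph 0
emptyGraph = record { adj = λ () ; sym = λ () ; irrefl = λ () }

emptyGraph-HasBlueMatching : HasBlueMatching 0 emptyGraph
emptyGraph-HasBlueMatching _ _ = [] , ([] , []) , refl

P₃-HasBlueMatching : HasBlueMatching 1 P₃
P₃-HasBlueMatching (c , c-sym) no-red with c 1F 0F in r
... | false = (1F , 0F) ∷ [] , (((λ ()) ∷ []) ∷ [] ∷ [] , (refl , r) ∷ []) , refl
... | true = (1F , 2F) ∷ [] , (((λ ()) ∷ []) ∷ [] ∷ [] , (refl , ≢true⇒≡false (no-red {y = 0F} (λ ()) refl refl r)) ∷ []) , refl

-- At most one spoke is red; the matching edge at its far end is discarded.
cone-arrows : ∀ {n p} {H : Graph p} → HasBlueMatching (suc n) H → Arrows (cone H) P₃ (Fan n)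
cone-arrows {n} {p} {H} robust c with redP₃-or-not (cone H) c
... | inj₁ red = inj₁ red
... | inj₂ no-red
  with L , M , l ← robust ((λ i j → proj₁ c (Fin.suc i) (Fin.suc j)) , λ i j → proj₂ c (Fin.suc i) (Fin.suc j))
                          (λ y≢z → no-red (y≢z ∘ Fin.suc-injective)) = inj₂ (spokes (Fin.any? λ i → proj₁ c Fin.zero (Fin.suc i) Bool.≟ true))
  where
  lift : ∀ {R L} → IsMatching R L → (∀ {a b} → R a b → BlueTriangle (cone H) c Fin.zero (Fin.suc a) (Fin.suc b)) →
    n ≤ length L → HasColouredCopy (cone H) c false (Fan n)
  lift {L = L} (u , es) f le = matching⇒fan (cone H) c {z = Fin.zero}
    (subst Unique (≡.sym (verts-map Fin.suc L)) (Unique.map⁺ Fin.suc-injective u) , All.map⁺ (All.map f es))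
    (≤-trans le (≤-reflexive (≡.sym (length-map _ L))))
  spokes : Dec (∃[ i ] proj₁ c Fin.zero (Fin.suc i) ≡ true) → HasColouredCopy (cone H) c false (Fan n)
  spokes (no ¬red) = lift M
    (λ ab → (refl , ≢true⇒≡false (¬red ∘ (_ ,_))) , (refl , ≢true⇒≡false (¬red ∘ (_ ,_))) , ab)
    (≤-trans (n≤1+n n) (≤-reflexive (≡.sym l)))
  spokes (yes (v , red)) with L′ , M′ , le ← remove v M = lift M′
    (λ { (ab , a≢v , b≢v) → (refl , blue a≢v) , (refl , blue b≢v) , ab })
    (≤-pred (≤-trans (≤-reflexive (≡.sym l)) le))
    where
    blue : ∀ {i} → i ≢ v → proj₁ c Fin.zero (Fin.suc i) ≡ false
    blue i≢v = ≢true⇒≡false λ r → no-red (i≢v ∘ Fin.suc-injective) refl refl r red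

-- The exceptional graph for n = 2

K₅ : Graph 5
K₅ = cone (cone (cone (cone (cone emptyGraph))))

K₅-adj : ∀ {i j} → i ≢ j → adj K₅ i j ≡ true
K₅-adj = cone-complete (cone-complete (cone-complete (cone-complete (cone-complete λ { {()} }))))
  where
  cone-complete : ∀ {p} {H : Graph p} → (∀ {i j} → i ≢ j → adj H i j ≡ true) → ∀ {i j} → i ≢ j → adj (cone H) i j ≡ true
  cone-complete h {Fin.zero} {Fin.zero} i≢j = contradiction refl i≢j
  cone-complete h {Fin.zero} {Fin.suc j} i≢j = refl
  cone-complete h {Fin.suc i} {Fin.zero} i≢j = refl
  cone-complete h {Fin.suc i} {Fin.suc j} i≢j = h (i≢j ∘ cong Fin.suc)

K₅-arrows : Arrows K₅ P₃ (Fan 2)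
K₅-arrows (c , c-sym) with redP₃-or-not K₅ (c , c-sym)
... | inj₁ red = inj₁ red
... | inj₂ no-red = inj₂ (search (c 0F 1F) (c 0F 2F) (c 0F 3F) (c 0F 4F) refl refl refl refl)
  where
  Goal : Set
  Goal = HasColouredCopy K₅ (c , c-sym) false (Fan 2)

  flip : ∀ {b} x y → c x y ≡ b → c y x ≡ b
  flip x y = ≡.trans (c-sym y x)

  blue : ∀ {x y z} → y ≢ z → x ≢ y → x ≢ z → c x y ≡ true → c x z ≡ false
  blue y≢z x≢y x≢z r = ≢true⇒≡false (no-red y≢z (K₅-adj x≢y) (K₅-adj x≢z) r)

  -- A vertex v without red edges is the centre: the other four vertices span a K₄, from which
  -- a red matching cannot delete an edge of each of the perfect matchings ab, de and ad, be.
  centre : ∀ {v a b d e} → Unique (v ∷ a ∷ b ∷ d ∷ e ∷ []) →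
    c v a ≡ false → c v b ≡ false → c v d ≡ false → c v e ≡ false → Goal
  centre {v} {a} {b} {d} {e} ((va ∷ vb ∷ vd ∷ ve ∷ []) ∷ u@((ab ∷ ad ∷ ae ∷ []) ∷ (bd ∷ be ∷ []) ∷ (de ∷ []) ∷ _)) ra rb rd re =
    pairs (c a b) (c d e) refl refl
    where
    good : ∀ {x y} → x ≢ y → c x y ≡ false → BlueEdge K₅ (c , c-sym) x y
    good x≢y r = K₅-adj x≢y , r
    other : c a d ≡ false → c b e ≡ false → Goal
    other r s = matching⇒fan K₅ (c , c-sym) {L = (a , d) ∷ (b , e) ∷ []}
      (Unique-resp-↭ (prep a (swap b d refl)) u ,
       (good va ra , good vd rd , good ad r) ∷ (good vb rb , good ve re , good be s) ∷ []) ≤-refl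
    pairs : ∀ r s → c a b ≡ r → c d e ≡ s → Goal
    pairs false false r s = matching⇒fan K₅ (c , c-sym) {L = (a , b) ∷ (d , e) ∷ []}
      (u , (good va ra , good vb rb , good ab r) ∷ (good vd rd , good ve re , good de s) ∷ []) ≤-refl
    pairs true _ r s = other (blue bd ab ad r) (blue ae (ab ∘ ≡.sym) be (flip a b r))
    pairs false true r s = other (flip d a (blue (ae ∘ ≡.sym) de (ad ∘ ≡.sym) s)) (flip e b (blue (bd ∘ ≡.sym) (de ∘ ≡.sym) (be ∘ ≡.sym) (flip d e s)))

  -- Besides the red edge `va`, at most one of the three edges among `b`, `d`, `e` is red, so one of
  -- these vertices has no red edge and can be the centre.
  matched : ∀ {v a b d e} → Unique (v ∷ a ∷ b ∷ d ∷ e ∷ []) → c v a ≡ true → Goal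
  matched {v} {a} {b} {d} {e} u@((va ∷ vb ∷ vd ∷ ve ∷ []) ∷ (ab ∷ ad ∷ ae ∷ []) ∷ (bd ∷ be ∷ []) ∷ (de ∷ []) ∷ _) r =
    second (c b d) (c b e) refl refl
    where
    from-v : ∀ {x} → a ≢ x → v ≢ x → c x v ≡ false
    from-v {x} ax vx = flip v x (blue ax va vx r)
    from-a : ∀ {x} → a ≢ x → v ≢ x → c x a ≡ false
    from-a {x} ax vx = flip a x (blue vx (va ∘ ≡.sym) ax (flip v a r))
    second : ∀ s t → c b d ≡ s → c b e ≡ t → Goal
    second false false s t = centre (Unique-resp-↭ (trans (prep v (swap a b refl)) (swap v b refl)) u)
      (from-v ab vb) (from-a ab vb) s t
    second true _ s t = centre {e} {v} {a} {b} {d} (Unique-resp-↭ ((shift e (v ∷ a ∷ b ∷ d ∷ []) [])) u)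
      (from-v ae ve) (from-a ae ve) (flip b e (blue de bd be s)) (flip d e (blue be (bd ∘ ≡.sym) de (flip b d s)))
    second false true s t = centre {d} {v} {a} {b} {e} (Unique-resp-↭ ((shift d (v ∷ a ∷ b ∷ []) (e ∷ []))) u)
      (from-v ad vd) (from-a ad vd) s′ (flip e d (blue bd (be ∘ ≡.sym) (de ∘ ≡.sym) (flip b e t)))
      where s′ = flip b d s

  u₀ : Unique (0F ∷ 1F ∷ 2F ∷ 3F ∷ 4F ∷ [])
  u₀ = Unique.allFin⁺ 5

  search : ∀ p q r s → c 0F 1F ≡ p → c 0F 2F ≡ q → c 0F 3F ≡ r → c 0F 4F ≡ s → Goal
  search true _ _ _ p q r s = matched u₀ p
  search false true _ _ p q r s = matched (Unique-resp-↭ (prep 0F (swap 1F 2F refl)) u₀) q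
  search false false true _ p q r s = matched (Unique-resp-↭ (prep 0F ((shift 3F (1F ∷ 2F ∷ []) (4F ∷ [])))) u₀) r
  search false false false true p q r s = matched (Unique-resp-↭ (prep 0F ((shift 4F (1F ∷ 2F ∷ 3F ∷ []) []))) u₀) s
  search false false false false p q r s = centre u₀ p q r s

-- Upper and lower bounds by parity

upper-odd : ∀ k → ∃[ p ] Σ (Graph p) λ G → edgeCount G ≡ 4 * suc (2 * k) + 4 × Arrows G P₃ (Fan (suc (2 * k)))
upper-odd k = _ , cone H , edges , cone-arrows {H = H} (subst (λ s → HasBlueMatching s H) (size≡ k)
    (four-cycles-HasBlueMatching (suc k) emptyGraph-HasBlueMatching))
  where
  H = four-cycles (suc k) emptyGraph
  size≡ : ∀ k → suc k * 2 + 0 ≡ suc (suc (2 * k))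
  size≡ = solve-∀
  count : ∀ k → suc k * 4 + 0 + (suc k * 4 + 0) ≡ 4 * suc (2 * k) + 4
  count = solve-∀
  edges : edgeCount (cone H) ≡ 4 * suc (2 * k) + 4
  edges = ≡.trans (edgeCount-cone H) (≡.trans (cong (suc k * 4 + 0 +_) (edgeCount-four-cycles (suc k) emptyGraph)) (count k))

upper-even : ∀ k → ∃[ p ] Σ (Graph p) λ G → edgeCount G ≡ 4 * (2 * k) + 5 × Arrows G P₃ (Fan (2 * k))
upper-even k = _ , cone H , edges , cone-arrows {H = H} (subst (λ s → HasBlueMatching s H) (size≡ k)
    (four-cycles-HasBlueMatching k P₃-HasBlueMatching))
  where
  H = four-cycles k P₃
  size≡ : ∀ k → k * 2 + 1 ≡ suc (2 * k)
  size≡ = solve-∀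
  count : ∀ k → k * 4 + 3 + (k * 4 + 2) ≡ 4 * (2 * k) + 5
  count = solve-∀
  edges : edgeCount (cone H) ≡ 4 * (2 * k) + 5
  edges = ≡.trans (edgeCount-cone H) (≡.trans (cong (k * 4 + 3 +_) (edgeCount-four-cycles k P₃)) (count k))

lower-odd : ∀ k {p} (G : Graph p) → Arrows G P₃ (Fan (suc (2 * k))) → 4 * suc (2 * k) + 4 ≤ edgeCount G
lower-odd zero G arr = SingleTriangle.triangle-lower-bound G arr
lower-odd (suc k) G arr with LargeFans.lower-bound G {suc (2 * suc k)} (s≤s (s≤s z≤n)) arr
-- The bound 6n - 2 is at least 4n + 4 from n = 3 on; the slack is 2n - 6 = 4k.
... | inj₁ h = +-cancelˡ-≤ 2 _ _ (≤-trans (≤-trans (m≤m+n _ (4 * k)) (≤-reflexive (eq k))) h)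
  where
  eq : ∀ k → 2 + (4 * suc (2 * suc k) + 4) + 4 * k ≡ 6 * suc (2 * suc k)
  eq = solve-∀
... | inj₂ (h , _) = ≤-trans (≤-reflexive (eq k)) h
  where
  eq : ∀ k → 4 * suc (2 * suc k) + 4 ≡ 4 * suc (suc (2 * suc k))
  eq = solve-∀

lower-even : ∀ k {p} (G : Graph p) → Arrows G P₃ (Fan (2 * (2 + k))) → 4 * (2 * (2 + k)) + 5 ≤ edgeCount G
lower-even k G arr with LargeFans.lower-bound G {2 * (2 + k)} (s≤s (≤-trans (s≤s z≤n) (m≤n+m _ (suc k)))) arr
-- The bound 6n - 2 exceeds 4n + 5 from n = 4 on, with slack 2n - 7 = 1 + 4k; this fails at n = 2.
... | inj₁ h = +-cancelˡ-≤ 2 _ _ (≤-trans (≤-trans (m≤m+n _ (1 + 4 * k)) (≤-reflexive (eq k))) h)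
  where
  eq : ∀ k → 2 + (4 * (2 * (2 + k)) + 5) + (1 + 4 * k) ≡ 6 * (2 * (2 + k))
  eq = solve-∀
... | inj₂ (h , h≢) = ≤-trans (≤-reflexive (eq k)) (≤∧≢⇒< h (h≢ (2 + k , refl)))
  where
  eq : ∀ k → 4 * (2 * (2 + k)) + 5 ≡ suc (4 * suc (2 * (2 + k)))
  eq = solve-∀

lower-two : ∀ {p} (G : Graph p) → Arrows G P₃ (Fan 2) → 10 ≤ edgeCount G
lower-two G arr with LargeFans.lower-bound G {2} ≤-refl arr
... | inj₁ h = +-cancelˡ-≤ 2 _ _ h
... | inj₂ (h , _) = ≤-trans (m≤n+m 10 2) h

theorem4 : (n : ℕ) → 1 ≤ n →
    (n ≡ 2 → IsSizeRamsey P₃ (Fan n) 10) ×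
    ((∃[ k ] n ≡ suc (2 * k)) → IsSizeRamsey P₃ (Fan n) (4 * n + 4)) ×
    ((∃[ k ] n ≡ 2 * k) → n ≢ 2 → IsSizeRamsey P₃ (Fan n) (4 * n + 5))
theorem4 n 1≤n = two , odd , even
  where
  two : n ≡ 2 → IsSizeRamsey P₃ (Fan n) 10
  two refl = (5 , K₅ , refl , K₅-arrows) , λ _ G → lower-two G
  odd : (∃[ k ] n ≡ suc (2 * k)) → IsSizeRamsey P₃ (Fan n) (4 * n + 4)
  odd (k , refl) = upper-odd k , λ _ G → lower-odd k G
  even : (∃[ k ] n ≡ 2 * k) → n ≢ 2 → IsSizeRamsey P₃ (Fan n) (4 * n + 5)
  even (zero , refl) _ = contradiction 1≤n λ ()
  even (suc zero , refl) n≢2 = contradiction refl n≢2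
  even (suc (suc k) , refl) _ = upper-even (2 + k) , λ _ G → lower-even k G
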